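{- Let $\mathbf{m}=(m_0,\dots,m_\ell)$ be a multiplicity vector of magnitude $n$, and let $\mathcal{B}$ be a skewed binary partition of $[0,n]$. Then $\mathcal{B}\in\mathcal{SBP}(\mathbf{m})$ if and only if $\mathrm{type}(\mathcal{B})=(b_{ -1},b_0,\dots,b_p)$ satisfies the following conditions: (1) $0<|b_{ -1}|+|b_0|\le m_0$ if and only if $b_0=0$ (the undecorated symbol $0$, as opposed to $0^\circ$). (2) $m_0<|b_{ -1}|+|b_0|+|b_1|$ (if $p=0$, this inequality is read as $m_0<|b_{ -1}|+|b_0|$), and for every positive integer $i\le\ell$ there exists at most one positive integer $j$ (with $j\le p$) such that $$m_0+\cdots+m_{i-1}\le|b_{ -1}|+\cdots+|b_{j-1}|<|b_{ -1}|+\cdots+|b_j|\le m_0+\cdots+m_i.\qquad(*)$$ (3) For $1\le j\le p$: if there exists a positive integer $i\le\ell$ satisfying $(*)$, then $b_j$ is an undecorated positive integer; otherwise $b_j\in\mathbb{P}^\star_{\ge2}$, i.e. $b_j$ is a $\star$-decorated integer.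
   Context: A multiplicity vector of magnitude $n$ is a tuple $\mathbf{m}=(m_0,m_1,\dots,m_\ell)$ of integers with $\ell\ge1$, $m_0\ge0$, $m_1,\dots,m_\ell\ge1$ and $m_0+\cdots+m_\ell=n$. Skewed binary partitions. A skewed binary partition of $[0,n]=\{0,\dots,n\}$ is an ordered tuple $\mathcal{B}=(B_{ -1},B_0,B_1,\dots,B_k)$, $k\ge0$, of disjoint subsets with union $[0,n]$, each labelled homogeneous or non-homogeneous, such that: $B_{ -1}$ is non-homogeneous, and $B_0$ is homogeneous if $|B_0|\ge2$; $0\in B_{ -1}\cup B_0$, and if $0\in B_{ -1}$ then $|B_{ -1}|\ge2$ and $B_0=\emptyset$; for $0\le i\le k$, if $B_i$ is a singleton it is non-homogeneous; $B_i\ne\emptyset$ for $1\le i\le k$. Preorder. $\preceq_{\mathcal{B}}$ is the preorder on $[0,n]$ with $p\preceq_{\mathcal{B}}q$ iff $p=q$, or $p\in B_i,q\in B_j$ with $i<j$, or $p,q$ lie in a common homogeneous block. Contraction. A preorder $\preceq$ has equivalence classes under $i\equiv j\iff i\preceq j\preceq i$ and induces a partial order on them; its Hasse diagram is that of this poset of classes. A preorder $\preceq_1$ is a contraction of $\preceq_2$ if its Hasse diagram is obtained from that of $\preceq_2$ by a (possibly empty) sequence of edge contractions, where contracting an edge $\bar g\lessdot\bar h$ merges the classes $\bar g,\bar h$, the new preorder being the transitive closure of the old one together with $\bar h\preceq\bar g$. A skewed binary partition $\mathcal{C}$ is a contraction of $\mathcal{B}$ if $\preceq_{\mathcal{C}}$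 is a contraction of $\preceq_{\mathcal{B}}$. Type. $\mathrm{type}(\mathcal{B})=(b_{ -1},b_0,\dots,b_k)$, where entries are nonnegative integers, possibly decorated by $\circ$ or $\star$: for $1\le i\le k$, $b_i=|B_i|$ if $B_i$ is non-homogeneous and $b_i=|B_i|^\star$ if homogeneous; if $0\in B_0$ then $b_0=(|B_0|-1)^\circ$ and $b_{ -1}=|B_{ -1}|$; if $0\in B_{ -1}$ then $b_0=0$ (undecorated, distinct from $0^\circ$) and $b_{ -1}=|B_{ -1}|-1$. The absolute value takes the numerical value: $|i|=|i^\circ|=|i^\star|=i$. $\mathbb{P}^\star_{\ge2}=\{i^\star : i\ge2\}$. $\Omega_{\mathbf{m}}$. Let $r=m_1+\cdots+m_\ell$. $\Omega_{\mathbf{m}}=\{\mathbf{a}_0,\dots,\mathbf{a}_r\}$, where $\mathbf{a}_0=(m_0,0,m_1,\dots,m_\ell)$ if $m_0>0$, $\mathbf{a}_0=(0,0^\circ,m_1,\dots,m_\ell)$ if $m_0=0$; for $1\le i<r$, $\mathbf{a}_i=(m_0+i,0^\circ,m_1+\cdots+m_g-i,m_{g+1},\dots,m_\ell)$, where $g$ is the unique positive integer with $m_1+\cdots+m_{g-1}\le i<m_1+\cdots+m_g$; and $\mathbf{a}_r=(n,0^\circ)$. $\mathcal{SBP}(\mathbf{m})$ is the set of all skewed binary partitions of $[0,n]$ that are contractions of some skewed binary partition $\mathcal{A}$ with $\mathrm{type}(\mathcal{A})\in\Omega_{\mathbf{m}}$. -}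

module Defs where

open import Data.Fin using (Fin; zero; suc; toℕ) renaming (_<_ to _<ᶠ_)
open import Data.Fin.Subset using (Subset; _∈_; ∣_∣; Nonempty; Empty)
open import Data.Fin.Subset.Properties using (_∈?_)
open import Data.List using (List; []; _∷_; length; map; sum; take; drop)
open import Data.List.Relation.Unary.All using (All)
open import Data.Nat using (ℕ; suc; _+_; _∸_; _≤_; _<_)
open import Data.Product using (∃-syntax; _×_)
open import Data.Sum using (_⊎_)
open import Data.Vec using (Vec; toList; tabulate) renaming (_∷_ to _∷ᵛ_)
open import Level using (Level; 0ℓ)
open import Relation.Binary.Core using (Rel; _⇔_)
open import Relation.Binary.Construct.Closure.ReflexiveTransitive using (Star)
open import Relation.Binary.Construct.Closure.Transitive using (TransClosure)
open import Relation.Binary.PropositionalEquality using (_≡_)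
open import Relation.Nullary using (¬_; yes; no)

-- (m₀ , m₁ , … , m_ℓ), with m₁ , … , m_ℓ collected in the list ms.
record MultiplicityVector (n : ℕ) : Set where
  field
    m₀        : ℕ
    ms        : List ℕ
    positive  : All (1 ≤_) ms
    magnitude : m₀ + sum ms ≡ n
    ℓ≥1       : 1 ≤ length ms

  ℓ : ℕ
  ℓ = length ms

  -- M i = m₀ + m₁ + ⋯ + mᵢ
  M : ℕ → ℕ
  M i = m₀ + sum (take i ms)

data Label : Set where
  homogeneous nonHomogeneous : Label

-- [0,n] is Fin (suc n).  Blocks are indexed by Fin (2 + k) with a shift:
-- zero, suc zero and suc (suc i) stand for the indices -1, 0 and toℕ i + 1.
record SkewedBinaryPartition (n : ℕ) : Set where
  field
    k     : ℕ
    block : Fin (2 + k) → Subset (suc n)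
    label : Fin (2 + k) → Label

  B₋₁ : Subset (suc n)
  B₋₁ = block zero

  B₀ : Subset (suc n)
  B₀ = block (suc zero)

  field
    disjoint : ∀ {i j p} → p ∈ block i → p ∈ block j → i ≡ j
    covering : ∀ p → ∃[ i ] p ∈ block i

    B₋₁-nonHomogeneous : label zero ≡ nonHomogeneous
    B₀-homogeneous     : 2 ≤ ∣ B₀ ∣ → label (suc zero) ≡ homogeneous

    0∈B₋₁∪B₀ : zero ∈ B₋₁ ⊎ zero ∈ B₀
    0∈B₋₁⇒   : zero ∈ B₋₁ → 2 ≤ ∣ B₋₁ ∣ × Empty B₀

    singleton : ∀ (i : Fin (suc k)) → ∣ block (suc i) ∣ ≡ 1 →
                label (suc i) ≡ nonHomogeneous
    nonempty  : ∀ (i : Fin k) → Nonempty (block (suc (suc i)))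

  _≼_ : Rel (Fin (suc n)) 0ℓ
  p ≼ q = p ≡ q
        ⊎ (∃[ i ] ∃[ j ] (i <ᶠ j × p ∈ block i × q ∈ block j))
        ⊎ (∃[ i ] (label i ≡ homogeneous × p ∈ block i × q ∈ block i))

-- Hasse diagrams live on the classes of p ≼ q ≼ p; a class is given by any of
-- its representatives.
module _ {a : Level} {A : Set a} where

  _[_≺_] : Rel A a → A → A → Set a
  R [ p ≺ q ] = R p q × ¬ R q p

  -- The class of g is covered by the class of h.
  _[_⋖_] : Rel A a → A → A → Set a
  R [ g ⋖ h ] = R [ g ≺ h ] × ¬ (∃[ z ] (R [ g ≺ z ] × R [ z ≺ h ]))

  -- Adding h ≼ g for one pair of representatives suffices, since the
  -- transitive closure propagates it to their classes.
  data Adjoin (R : Rel A a) (g h : A) : Rel A a where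
    old : ∀ {x y} → R x y → Adjoin R g h x y
    new : Adjoin R g h h g

  EdgeContraction : Rel (Rel A a) _
  EdgeContraction R S =
    ∃[ g ] ∃[ h ] (R [ g ⋖ h ] × (S ⇔ TransClosure (Adjoin R g h)))

  -- The final ⇔ lets equality of preorders be extensional, also for the empty
  -- sequence of contractions.
  _IsPreorderContractionOf_ : Rel (Rel A a) _
  R₁ IsPreorderContractionOf R₂ = ∃[ S ] (Star EdgeContraction R₂ S × (S ⇔ R₁))

_IsContractionOf_ : ∀ {n} → Rel (SkewedBinaryPartition n) _
C IsContractionOf B =
  SkewedBinaryPartition._≼_ C IsPreorderContractionOf SkewedBinaryPartition._≼_ B

data Entry : Set where
  plain : ℕ → Entry
  _°    : ℕ → Entry
  _⋆    : ℕ → Entry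

∣_∣ₑ : Entry → ℕ
∣ plain i ∣ₑ = i
∣ i °     ∣ₑ = i
∣ i ⋆     ∣ₑ = i

module _ {n : ℕ} (B : SkewedBinaryPartition n) where
  open SkewedBinaryPartition B

  decorate : Label → ℕ → Entry
  decorate homogeneous    i = i ⋆
  decorate nonHomogeneous i = plain i

  -- Same index shift as for blocks.
  type : Vec Entry (2 + k)
  type with zero ∈? B₀
  ... | yes _ = plain ∣ B₋₁ ∣ ∷ᵛ ((∣ B₀ ∣ ∸ 1) °) ∷ᵛ
                tabulate (λ i → decorate (label (suc (suc i))) ∣ block (suc (suc i)) ∣)
  ... | no  _ = plain (∣ B₋₁ ∣ ∸ 1) ∷ᵛ plain 0 ∷ᵛ
                tabulate (λ i → decorate (label (suc (suc i))) ∣ block (suc (suc i)) ∣)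

-- b ∈Ω m, where Ω_m = { a₀ , … , a_r }.
data _∈Ω_ {n : ℕ} : List Entry → MultiplicityVector n → Set where
  a₀-pos  : ∀ {m} → let open MultiplicityVector m in
            0 < m₀ →
            (plain m₀ ∷ plain 0 ∷ map plain ms) ∈Ω m
  a₀-zero : ∀ {m} → let open MultiplicityVector m in
            m₀ ≡ 0 →
            (plain 0 ∷ (0 °) ∷ map plain ms) ∈Ω m
  -- The index g ≥ 1 is suc g′; the two bounds on i force
  -- suc g′ ≤ ℓ and determine g′.
  aᵢ      : ∀ {m} (i g′ : ℕ) → let open MultiplicityVector m in
            1 ≤ i → i < sum ms →
            sum (take g′ ms) ≤ i → i < sum (take (suc g′) ms) →
            (plain (m₀ + i) ∷ (0 °) ∷ plain (sum (take (suc g′) ms) ∸ i)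
              ∷ map plain (drop (suc g′) ms)) ∈Ω m
  aᵣ      : ∀ {m} → (plain n ∷ (0 °) ∷ []) ∈Ω m

_∈𝒮ℬ𝒫_ : ∀ {n} → SkewedBinaryPartition n → MultiplicityVector n → Set₁
B ∈𝒮ℬ𝒫 m = ∃[ A ] (toList (type A) ∈Ω m × B IsContractionOf A)

-- S b j = |b₋₁| + |b₀| + ⋯ + |bⱼ|, truncated to |b₋₁| + ⋯ + |b_p| if p < j.
S : ∀ {p} → Vec Entry (2 + p) → ℕ → ℕ
S b j = sum (map ∣_∣ₑ (take (2 + j) (toList b)))

-- m₀ + ⋯ + m_{i-1} ≤ |b₋₁| + ⋯ + |b_{j-1}| < |b₋₁| + ⋯ + |bⱼ| ≤ m₀ + ⋯ + mᵢ
-- for 1 ≤ i ≤ ℓ and 1 ≤ j ≤ p, which are given here as i - 1 : Fin ℓ and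
-- j - 1 : Fin p.
Fits : ∀ {n p} (m : MultiplicityVector n) → Vec Entry (2 + p) →
       Fin (MultiplicityVector.ℓ m) → Fin p → Set
Fits m b i j =
  M (toℕ i) ≤ S b (toℕ j) ×
  S b (toℕ j) < S b (suc (toℕ j)) ×
  S b (suc (toℕ j)) ≤ M (suc (toℕ i))
  where open MultiplicityVector m

module Submission where

open import Data.Empty using (⊥-elim)
open import Data.Fin using (Fin; zero; suc; toℕ; fromℕ<; combine; remQuot; opposite)
open import Data.Fin.Properties
  using (any?; remQuot-combine; toℕ-injective; toℕ<n; toℕ-fromℕ<; opposite-prop)
  renaming (_≟_ to _≟ᶠ_; suc-injective to sucᶠ-injective)
open import Data.Fin.Subset using (Subset; _∈_; ∣_∣; ⁅_⁆; ⊥; ⊤; Nonempty; Empty)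
open import Data.Fin.Subset.Properties
  using ( _∈?_; nonempty?; Empty-unique; x∈p⇒∣p-x∣<∣p∣; x∈⁅x⁆
        ; p⊆q⇒∣p∣≤∣q∣; p⊂q⇒∣p∣<∣q∣; ∣p∣≤n; ∣⁅x⁆∣≡1; ∣⊥∣≡0; ∣⊤∣≡n)
open import Data.List as List using (List; []; _∷_; length; map; take; drop) renaming (_++_ to _++ᴸ_)
open import Data.List.Membership.Propositional.Properties using (∈-lookup)
open import Data.List.Properties
  using (take-[]; take-all; take++drop≡id; ∷-injectiveˡ; ∷-injectiveʳ)
open import Data.List.Relation.Unary.All as All using (All) renaming ([] to []ᵃ; _∷_ to _∷ᵃ_)
open import Data.List.Relation.Unary.All.Properties using (drop⁺)
open import Data.Nat
open import Data.Nat.Induction using (<-wellFounded)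
open import Data.Nat.ListAction using (sum)
open import Data.Nat.ListAction.Properties using (sum-++)
open import Data.Nat.Properties
open import Data.Product using (∃-syntax; _×_; _,_; proj₁; proj₂; uncurry)
open import Data.Sum using (_⊎_; inj₁; inj₂; [_,_]′)
open import Data.Vec using (tabulate; toList; lookup) renaming (_∷_ to _∷ᵛ_)
open import Data.Vec.Properties using (lookup∘tabulate; lookup⇒[]=; []=⇒lookup)
open import Function using (_∘_; id; case_of_)
open import Function.Bundles using (_⇔_; Equivalence; mk⇔)
open import Induction.WellFounded using (Acc; acc)
open import Level using (0ℓ)
open import Relation.Binary.Core using (Rel; _⇒_) renaming (_⇔_ to _⇔ᴿ_)
open import Relation.Binary.Construct.Closure.ReflexiveTransitive using (Star; ε; _◅_)
open import Relation.Binary.Construct.Closure.Transitive using (TransClosure; [_]; _∷_; _++_)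
open import Relation.Binary.Definitions
  using (Reflexive; Transitive; tri<; tri≈; tri>) renaming (Decidable to Decidable₂)
open import Relation.Binary.PropositionalEquality
  using (_≡_; _≢_; refl; sym; trans; cong; cong₂; subst; module ≡-Reasoning)
open import Relation.Nullary using (¬_; Dec; does; yes; no; ¬?; _×-dec_; _⊎-dec_)
open import Relation.Nullary.Decidable using (dec-true; decidable-stable)
open import Relation.Unary using (Pred; Decidable)
open import Defs

-- Contracting Hasse edges of ≼_A yields ≼_B exactly when ≼_A ⊆ ≼_B and ≼_B is generated
-- by ≼_A together with the reversed ≼_A-steps inside ≼_B-classes.  For types in Ω_m all
-- classes of A are singletons, so ≼_A is an ordinal sum of antichains, and the criterion
-- becomes one about initial segments: every antichain block of B lies inside one level of A,
-- no homogeneous block does, and different antichain blocks lie in different levels.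
-- Initial segments of A and B are comparable under inclusion, so containment of blocks in
-- levels can be read off from cardinalities, that is, from the partial sums in the two types,
-- where it turns into (∗).  Conversely, listing [0,n] block by block along B, with 0 at the
-- end of its block, and cutting the list according to a suitable type in Ω_m gives A: the
-- type a₀ if |b₋₁| + |b₀| ≤ m₀ and the one starting with |b₋₁| + |b₀| otherwise.

-- Preorder contractions

-- Each edge contraction changes the Hasse diagram on which the next one acts, so a sequence of
-- contractions is hard to compare with anything; the criterion therefore refers to its first and
-- last preorder only. In the numerical part the delicate element is 0, which `type` does not count.
-- Every cut after the first two blocks lies at 1 plus a partial sum of the type, for A as well as
-- for B, so the ones cancel and inclusions of initial segments become inequalities between partial
-- sums. The cut between the first two blocks is different: its position depends on which of them
-- contains 0. Hence the tail entries are treated uniformly through `Frame`, whereas condition (1)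
-- and the bound on `m₀` need the distinction between `early` (0 lies in the first block of A) and
-- `late` (0 alone forms the second block of A). The first two blocks may moreover be empty, and
-- cardinalities locate an empty block nowhere in particular. For this reason containment is always
-- used at an element of the block.

module _ {N : ℕ} where

  comprehension : {P : Pred (Fin N) 0ℓ} → Decidable P → Subset N
  comprehension P? = tabulate (does ∘ P?)

  module _ {P : Pred (Fin N) 0ℓ} (P? : Decidable P) where

    ∈-comprehension⁺ : ∀ {x} → P x → x ∈ comprehension P?
    ∈-comprehension⁺ {x} px =
      lookup⇒[]= x _ (trans (lookup∘tabulate (does ∘ P?) x) (dec-true (P? x) px))

    ∈-comprehension⁻ : ∀ {x} → x ∈ comprehension P? → P x
    ∈-comprehension⁻ {x} x∈ with P? x | trans (sym (lookup∘tabulate (does ∘ P?) x)) ([]=⇒lookup x∈)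
    ... | yes px | _  = px
    ... | no _   | ()

  module _ {P Q : Pred (Fin N) 0ℓ} (P? : Decidable P) (Q? : Decidable Q) where

    comprehension-mono-≤ : (∀ {x} → P x → Q x) →
                           ∣ comprehension P? ∣ ≤ ∣ comprehension Q? ∣
    comprehension-mono-≤ P⊆Q =
      p⊆q⇒∣p∣≤∣q∣ (∈-comprehension⁺ Q? ∘ P⊆Q ∘ ∈-comprehension⁻ P?)

    comprehension-mono-< : (∀ {x} → P x → Q x) → ∀ {y} → ¬ P y → Q y →
                           ∣ comprehension P? ∣ < ∣ comprehension Q? ∣
    comprehension-mono-< P⊆Q {y} ¬py qy = p⊂q⇒∣p∣<∣q∣
      ( ∈-comprehension⁺ Q? ∘ P⊆Q ∘ ∈-comprehension⁻ P?
      , y , ∈-comprehension⁺ Q? qy , ¬py ∘ ∈-comprehension⁻ P?)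

  ∣comprehension∣≤1 : {P : Pred (Fin N) 0ℓ} (P? : Decidable P) →
                      (∀ {x y} → P x → P y → x ≡ y) → ∣ comprehension P? ∣ ≤ 1
  ∣comprehension∣≤1 P? unique with any? P?
  ... | yes (p , pp) = subst (_ ≤_) (∣⁅x⁆∣≡1 p) (p⊆q⇒∣p∣≤∣q∣ λ x∈ →
          subst (_∈ ⁅ p ⁆) (unique pp (∈-comprehension⁻ P? x∈)) (x∈⁅x⁆ p))
  ... | no ∄p = ≤-trans (p⊆q⇒∣p∣≤∣q∣ {q = ⊥} λ x∈ → ⊥-elim (∄p (_ , ∈-comprehension⁻ P? x∈)))
                  (≤-trans (≤-reflexive (∣⊥∣≡0 N)) z≤n)

∣comprehension∣-⊎ : ∀ {N} {P Q R : Pred (Fin N) 0ℓ}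
                    (P? : Decidable P) (Q? : Decidable Q) (R? : Decidable R) →
                    (∀ x → R x → P x ⊎ Q x) → (∀ x → P x → R x) → (∀ x → Q x → R x) →
                    (∀ x → P x → ¬ Q x) →
                    ∣ comprehension R? ∣ ≡ ∣ comprehension P? ∣ + ∣ comprehension Q? ∣
∣comprehension∣-⊎ {zero} P? Q? R? r p q d = refl
∣comprehension∣-⊎ {suc N} P? Q? R? r p q d
  with P? zero | Q? zero | R? zero
     | ∣comprehension∣-⊎ (P? ∘ suc) (Q? ∘ suc) (R? ∘ suc) (r ∘ suc) (p ∘ suc) (q ∘ suc) (d ∘ suc)
... | yes p₀ | yes q₀ | _      | _  = ⊥-elim (d zero p₀ q₀)
... | yes _  | no _   | yes _  | ih = cong suc ih
... | yes p₀ | no _   | no ¬r₀ | _  = ⊥-elim (¬r₀ (p zero p₀))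
... | no _   | yes _  | yes _  | ih = trans (cong suc ih) (sym (+-suc _ _))
... | no _   | yes q₀ | no ¬r₀ | _  = ⊥-elim (¬r₀ (q zero q₀))
... | no ¬p₀ | no ¬q₀ | yes r₀ | _  = ⊥-elim ([ ¬p₀ , ¬q₀ ]′ (r zero r₀))
... | no _   | no _   | no _   | ih = ih

data Unfold {A : Set} (R S : Rel A 0ℓ) : Rel A 0ℓ where
  forth : ∀ {x y} → R x y → Unfold R S x y
  back  : ∀ {x y} → R y x → S x y → Unfold R S x y

module _ {A : Set} {S : Rel A 0ℓ} (S-trans : Transitive S) where

  -- In the induction, every step of the contracted `R′` has to be rewritten in terms of `R`. A
  -- forward step is a path of `R`-steps and adjoined steps, and an adjoined step is the reversed
  -- edge from `g` to `h`, which is admissible since `R′` lies in `S`. Backward steps are left to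
  -- `reverse`.
  contraction⇒unfold : ∀ {R} → Star EdgeContraction R S →
                       (R ⇒ S) × (S ⇒ TransClosure (Unfold R S))
  contraction⇒unfold ε = id , λ s → [ forth s ]
  contraction⇒unfold {R} (_◅_ {j = R′} (g , h , ((Rgh , _) , _) , R′⇒ , ⇒R′) steps)
    with contraction⇒unfold steps
  ... | R′⇒S , S⇒ = (λ r → R′⇒S (⇒R′ [ old r ])) , λ s → expand (S⇒ s)
    where
    Adj = TransClosure (Adjoin R g h)

    stepwise : ∀ {x y} → Adj x y → TransClosure (Unfold R S) x y
    stepwise [ old r ]   = [ forth r ]
    stepwise [ new ]     = [ back Rgh (R′⇒S (⇒R′ [ new ])) ]
    stepwise (old r ∷ c) = forth r ∷ stepwise c
    stepwise (new ∷ c)   = back Rgh (R′⇒S (⇒R′ [ new ])) ∷ stepwise c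

    reverse₁ : ∀ {x y} → Adjoin R g h y x → S x y → Unfold R S x y
    reverse₁ (old r) s = back r s
    reverse₁ new     _ = forth Rgh

    -- The path from `y` to `x` and `S x y` close up to a cycle in `S`, so all points on the path
    -- are `S`-equivalent and each `R`-step can be reversed separately. The reversal of the adjoined
    -- step is the original edge `R g h`.
    reverse : ∀ {x y} → Adj y x → S x y → TransClosure (Unfold R S) x y
    reverse [ a ]   s = [ reverse₁ a s ]
    reverse (a ∷ c) s =
      reverse c (S-trans s (R′⇒S (⇒R′ [ a ]))) ++ [ reverse₁ a (S-trans (R′⇒S (⇒R′ c)) s) ]

    expand : ∀ {x y} → TransClosure (Unfold R′ S) x y → TransClosure (Unfold R S) x y
    expand [ forth r ]    = stepwise (R′⇒ r)
    expand [ back r s ]   = reverse (R′⇒ r) s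
    expand (forth r ∷ c)  = stepwise (R′⇒ r) ++ expand c
    expand (back r s ∷ c) = reverse (R′⇒ r) s ++ expand c

record Saturation {A : Set} (R S : Rel A 0ℓ) : Set₁ where
  field
    T         : Rel A 0ℓ
    steps     : Star EdgeContraction R T
    T-trans   : Transitive T
    T⇒S       : T ⇒ S
    R⇒T       : R ⇒ T
    saturated : ∀ {x y} → T x y → S y x → T y x

module _ {N : ℕ} where

  -- Only Hasse edges may be contracted, so a strict step is shortened at its upper end. Replacing
  -- `h` by an intermediate `z` removes at least `z` from the open interval, and finiteness ends the
  -- descent.
  cover : {R : Rel (Fin N) 0ℓ} → Reflexive R → Transitive R → Decidable₂ R →
          ∀ {g h} → R [ g ≺ h ] → ∃[ h′ ] (R [ g ⋖ h′ ] × R h′ h)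
  cover {R} R-refl R-trans R? g≺h = go g≺h (<-wellFounded _)
    where
    between? : ∀ g h → Decidable (λ z → R [ g ≺ z ] × R [ z ≺ h ])
    between? g h z = (R? g z ×-dec ¬? (R? z g)) ×-dec (R? z h ×-dec ¬? (R? h z))

    go : ∀ {g h} → R [ g ≺ h ] → Acc _<_ ∣ comprehension (between? g h) ∣ →
         ∃[ h′ ] (R [ g ⋖ h′ ] × R h′ h)
    go {g} {h} g≺h (acc rec) with any? (between? g h)
    ... | no ∄z = h , (g≺h , ∄z) , R-refl
    ... | yes (z , g≺z , z≺h@(Rzh , _))
      with h′ , g⋖h′ , Rh′z ← go g≺z (rec (comprehension-mono-< (between? g z) (between? g h)
             (λ (g≺w , Rwz , ¬Rzw) → g≺w , R-trans Rwz Rzh , λ Rhw → ¬Rzw (R-trans Rzh Rhw))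
             (λ (_ , Rzz , ¬Rzz) → ¬Rzz Rzz) (g≺z , z≺h)))
      = h′ , g⋖h′ , R-trans Rh′z Rzh

  module _ {S : Rel (Fin N) 0ℓ} (S-trans : Transitive S) (S? : Decidable₂ S) where

    -- Contracting covers between S-equivalent elements as long as possible makes
    -- every R-step inside an S-class reversible.
    saturate : {R : Rel (Fin N) 0ℓ} → Reflexive R → Transitive R → Decidable₂ R → R ⇒ S →
               Saturation R S
    saturate R-refl R-trans R? R⇒S = go R-refl R-trans R? R⇒S (<-wellFounded _)
      where
      -- Termination measure: pairs are coded in `Fin (N * N)` so that the counting of subsets
      -- applies. Contracting the edge from `g` to `h` relates the new pair `(h , g)`.
      unrelated? : {R : Rel (Fin N) 0ℓ} → Decidable₂ R →
                   Decidable {A = Fin (N * N)} (λ i → ¬ uncurry R (remQuot N i))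
      unrelated? R? i = ¬? (uncurry R? (remQuot N i))

      go : {R : Rel (Fin N) 0ℓ} → Reflexive R → Transitive R → (R? : Decidable₂ R) → R ⇒ S →
           Acc _<_ ∣ comprehension (unrelated? R?) ∣ →
           Saturation R S
      go {R} R-refl R-trans R? R⇒S (acc rec)
        with any? (λ x → any? (λ y → R? x y ×-dec S? y x ×-dec ¬? (R? y x)))
      ... | no ∄xy = record
              { T         = R
              ; steps     = ε
              ; T-trans   = R-trans
              ; T⇒S       = R⇒S
              ; R⇒T       = id
              ; saturated = λ {x} {y} Rxy Syx →
                  decidable-stable (R? y x) λ ¬Ryx → ∄xy (x , y , Rxy , Syx , ¬Ryx)
              }
      ... | yes (g , y , Rgy , Syg , ¬Ryg)
        -- The pair found need not be an edge. The cover `h` of `g` below `y` is still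
        -- `S`-equivalent to `g`, because `R h y` and `S y g`.
        with h , g⋖h@((Rgh , ¬Rhg) , _) , Rhy ← cover R-refl R-trans R? (Rgy , ¬Ryg)
        = extend (go {R′} (inj₁ R-refl) R′-trans R′? R′⇒S (rec smaller))
        where
        -- Closed form of the transitive closure after adjoining `h ≼ g`: a path that uses the new
        -- step several times can be shortened to a single use. In this form the relation stays
        -- decidable, as the recursion requires.
        R′ : Rel (Fin N) 0ℓ
        R′ x z = R x z ⊎ (R x h × R g z)

        R′? : Decidable₂ R′
        R′? x z = R? x z ⊎-dec (R? x h ×-dec R? g z)

        R′-trans : Transitive R′
        R′-trans (inj₁ a)       (inj₁ b)       = inj₁ (R-trans a b)
        R′-trans (inj₁ a)       (inj₂ (b , c)) = inj₂ (R-trans a b , c)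
        R′-trans (inj₂ (a , b)) (inj₁ c)       = inj₂ (a , R-trans b c)
        R′-trans (inj₂ (a , _)) (inj₂ (_ , d)) = inj₂ (a , d)

        R′⇒S : R′ ⇒ S
        R′⇒S (inj₁ a)       = R⇒S a
        R′⇒S (inj₂ (a , b)) = S-trans (R⇒S a) (S-trans (R⇒S Rhy) (S-trans Syg (R⇒S b)))

        R′⇒Adjoin : R′ ⇒ TransClosure (Adjoin R g h)
        R′⇒Adjoin (inj₁ a)       = [ old a ]
        R′⇒Adjoin (inj₂ (a , b)) = old a ∷ new ∷ [ old b ]

        Adjoin⇒R′ : Adjoin R g h ⇒ R′
        Adjoin⇒R′ (old a) = inj₁ a
        Adjoin⇒R′ new     = inj₂ (R-refl , R-refl)

        closure⇒R′ : TransClosure (Adjoin R g h) ⇒ R′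
        closure⇒R′ [ a ]   = Adjoin⇒R′ a
        closure⇒R′ (a ∷ c) = R′-trans (Adjoin⇒R′ a) (closure⇒R′ c)

        smaller : ∣ comprehension (unrelated? R′?) ∣ < ∣ comprehension (unrelated? R?) ∣
        smaller = comprehension-mono-< (unrelated? R′?) (unrelated? R?) (_∘ inj₁)
          {combine h g}
          (λ ¬R′ → ¬R′ (subst (uncurry R′) (sym (remQuot-combine h g)) (inj₂ (R-refl , R-refl))))
          (¬Rhg ∘ subst (uncurry R) (remQuot-combine h g))

        extend : Saturation R′ S → Saturation R S
        extend sat = record
          { T         = T
          ; steps     = (g , h , g⋖h , (λ {_} {_} → R′⇒Adjoin) , λ {_} {_} → closure⇒R′) ◅ steps
          ; T-trans   = T-trans
          ; T⇒S       = T⇒S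
          ; R⇒T       = R⇒T ∘ inj₁
          ; saturated = saturated
          }
          where open Saturation sat

    unfold⇒contraction : {R : Rel (Fin N) 0ℓ} → Reflexive R → Transitive R → Decidable₂ R →
                         R ⇒ S → S ⇒ TransClosure (Unfold R S) → S IsPreorderContractionOf R
    unfold⇒contraction {R} R-refl R-trans R? R⇒S S⇒
      = T , steps , T⇒S , fold ∘ S⇒
      where
      open Saturation (saturate R-refl R-trans R? R⇒S)

      fold₁ : Unfold R S ⇒ T
      fold₁ (forth r)  = R⇒T r
      fold₁ (back r s) = saturated (R⇒T r) s

      fold : TransClosure (Unfold R S) ⇒ T
      fold [ u ]   = fold₁ u
      fold (u ∷ c) = T-trans (fold₁ u) (fold c)

-- Level functions

module _ {N : ℕ} where

  #_below_ : (Fin N → ℕ) → ℕ → ℕ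
  # f below s = ∣ comprehension (λ p → f p <? s) ∣

  module _ {f g : Fin N → ℕ} {s t : ℕ} (⊆ : ∀ {p} → f p < s → g p < t) where

    #-mono-≤ : # f below s ≤ # g below t
    #-mono-≤ = comprehension-mono-≤ (λ p → f p <? s) (λ p → g p <? t) ⊆

    #-mono-< : ∀ {p} → s ≤ f p → g p < t → # f below s < # g below t
    #-mono-< s≤fp = comprehension-mono-< (λ p → f p <? s) (λ p → g p <? t) ⊆ (≤⇒≯ s≤fp)

  module _ (f : Fin N → ℕ) where

    #-monoʳ-≤ : ∀ {s t} → s ≤ t → # f below s ≤ # f below t
    #-monoʳ-≤ s≤t = #-mono-≤ {f} {f} (λ fp<s → <-≤-trans fp<s s≤t)

    #-suc : ∀ s → # f below suc s ≡ # f below s + ∣ comprehension (λ p → f p ≟ s) ∣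
    #-suc s = ∣comprehension∣-⊎ (λ p → f p <? s) (λ p → f p ≟ s) (λ p → f p <? suc s)
      (λ p fp<1+s → m≤n⇒m<n∨m≡n (s≤s⁻¹ fp<1+s)) (λ p → m<n⇒m<1+n)
      (λ p fp≡s → s≤s (≤-reflexive fp≡s)) (λ p → <⇒≢)

    #-zero : # f below 0 ≡ 0
    #-zero = n≤0⇒n≡0 (≤-trans
      (p⊆q⇒∣p∣≤∣q∣ {q = ⊥} (λ x∈ → ⊥-elim (n≮0 (∈-comprehension⁻ (λ p → f p <? 0) x∈))))
      (≤-reflexive (∣⊥∣≡0 N)))

    #≤N : ∀ s → # f below s ≤ N
    #≤N s = ∣p∣≤n (comprehension (λ p → f p <? s))

    #-full : ∀ {s} → (∀ p → f p < s) → # f below s ≡ N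
    #-full {s} f<s = ≤-antisym (#≤N s) (≤-trans (≤-reflexive (sym (∣⊤∣≡n N)))
      (p⊆q⇒∣p∣≤∣q∣ {p = ⊤} λ {x} _ → ∈-comprehension⁺ (λ p → f p <? s) (f<s x)))

    module _ (f-injective : ∀ {p q} → f p ≡ f q → p ≡ q) where

      #-slope : ∀ s d → # f below (d + s) ≤ d + # f below s
      #-slope s zero    = ≤-refl
      #-slope s (suc d) = begin
        # f below suc (d + s)                                         ≡⟨ #-suc (d + s) ⟩
        # f below (d + s) + ∣ comprehension (λ p → f p ≟ d + s) ∣
          ≤⟨ +-mono-≤ (#-slope s d) (∣comprehension∣≤1 (λ p → f p ≟ d + s)
               (λ fp≡ fq≡ → f-injective (trans fp≡ (sym fq≡)))) ⟩
        d + # f below s + 1                                           ≡⟨ +-comm _ 1 ⟩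
        suc d + # f below s                                           ∎
        where open ≤-Reasoning

      #-bijective : (∀ p → f p < N) → ∀ {s} → s ≤ N → # f below s ≡ s
      #-bijective f<N {s} s≤N = ≤-antisym upper (+-cancelˡ-≤ (N ∸ s) _ _ lower)
        where
        open ≤-Reasoning
        -- The count is 0 at 0, is `N` at `N`, and by injectivity grows by at most one per unit.
        -- Climbing from 0 bounds it above, descending from `N` bounds it below.
        upper : # f below s ≤ s
        upper = begin
          # f below s        ≡⟨ cong (#_below_ f) (+-identityʳ s) ⟨
          # f below (s + 0)  ≤⟨ #-slope 0 s ⟩
          s + # f below 0    ≡⟨ cong (s +_) #-zero ⟩
          s + 0              ≡⟨ +-identityʳ s ⟩
          s                  ∎
        lower : (N ∸ s) + s ≤ (N ∸ s) + # f below s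
        lower = begin
          (N ∸ s) + s            ≡⟨ m∸n+n≡m s≤N ⟩
          N                      ≡⟨ #-full f<N ⟨
          # f below N            ≡⟨ cong (#_below_ f) (m∸n+n≡m s≤N) ⟨
          # f below (N ∸ s + s)  ≤⟨ #-slope s (N ∸ s) ⟩
          (N ∸ s) + # f below s  ∎

-- The position of an element when the elements are listed level by level and
-- in decreasing order inside each level; thus 0 comes last in its level.
module Rank {N : ℕ} (f : Fin N → ℕ) where

  key : Fin N → ℕ
  key p = f p * N + toℕ (opposite p)

  rank : Fin N → ℕ
  rank p = # key below key p

  key-mono-< : ∀ {p q} → f p < f q → key p < key q
  key-mono-< {p} {q} fp<fq = begin-strict
    f p * N + toℕ (opposite p)  <⟨ +-monoʳ-< (f p * N) (toℕ<n (opposite p)) ⟩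
    f p * N + N                 ≡⟨ +-comm (f p * N) N ⟩
    suc (f p) * N               ≤⟨ *-monoˡ-≤ N fp<fq ⟩
    f q * N                     ≤⟨ m≤m+n (f q * N) _ ⟩
    key q                       ∎
    where open ≤-Reasoning

  opposite-injective : ∀ {p q : Fin N} → toℕ (opposite p) ≡ toℕ (opposite q) → p ≡ q
  opposite-injective {p} {q} eq = toℕ-injective (suc-injective (∸-cancelˡ-≡ (toℕ<n p) (toℕ<n q)
    (trans (sym (opposite-prop p)) (trans eq (opposite-prop q)))))

  key-injective : ∀ {p q} → key p ≡ key q → p ≡ q
  key-injective {p} {q} eq with <-cmp (f p) (f q)
  ... | tri< fp<fq _ _ = ⊥-elim (<⇒≢ (key-mono-< fp<fq) eq)
  ... | tri> _ _ fq<fp = ⊥-elim (<⇒≢ (key-mono-< fq<fp) (sym eq))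
  ... | tri≈ _ fp≡fq _ = opposite-injective (+-cancelˡ-≡ (f q * N) _ _
          (trans (cong (λ l → l * N + toℕ (opposite p)) (sym fp≡fq)) eq))

  rank-mono-< : ∀ {p q} → key p < key q → rank p < rank q
  rank-mono-< {p} kp<kq = #-mono-< {f = key} {key} (λ k<kp → <-trans k<kp kp<kq) {p} ≤-refl kp<kq

  rank-injective : ∀ {p q} → rank p ≡ rank q → p ≡ q
  rank-injective {p} {q} eq with <-cmp (key p) (key q)
  ... | tri< kp<kq _ _ = ⊥-elim (<⇒≢ (rank-mono-< kp<kq) eq)
  ... | tri> _ _ kq<kp = ⊥-elim (<⇒≢ (rank-mono-< kq<kp) (sym eq))
  ... | tri≈ _ kp≡kq _ = key-injective kp≡kq

  rank<N : ∀ p → rank p < N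
  rank<N p = <-≤-trans (#-mono-< {f = key} {key} {t = suc (key p)} m<n⇒m<1+n {p} ≤-refl ≤-refl)
                       (#≤N key (suc (key p)))

  #-rank : ∀ {s} → s ≤ N → # rank below s ≡ s
  #-rank = #-bijective rank rank-injective rank<N

  rank< : ∀ {p s} → f p < s → rank p < # f below s
  rank< {p} {s} fp<s = #-mono-< {f = key} {f} below {p} ≤-refl fp<s
    where
    below : ∀ {q} → key q < key p → f q < s
    below {q} kq<kp with f q <? s
    ... | yes fq<s = fq<s
    ... | no  fq≮s = ⊥-elim (<-asym kq<kp (key-mono-< (<-≤-trans fp<s (≮⇒≥ fq≮s))))

-- In its level 0 has the largest `opposite`, so everything up to that level is listed no later than
-- 0. For 0 in `B₀` this puts 0 exactly at the position that must become the singleton second block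
-- of A.
rank-zero : ∀ {N} (f : Fin (suc N) → ℕ) → # f below suc (f zero) ≡ suc (Rank.rank f zero)
rank-zero f = ≤-antisym
  (≤-trans (#-mono-≤ {f = f} {key} below) (#-slope key key-injective (key zero) 1))
  (rank< ≤-refl)
  where
  open Rank f
  below : ∀ {q} → f q < suc (f zero) → key q < suc (key zero)
  below {q} fq≤ with m≤n⇒m<n∨m≡n (s≤s⁻¹ fq≤)
  ... | inj₁ fq<f0 = m<n⇒m<1+n (key-mono-< fq<f0)
  ... | inj₂ fq≡f0 = s≤s (+-mono-≤ (≤-reflexive (cong (_* _) fq≡f0))
          (≤-trans (s≤s⁻¹ (toℕ<n (opposite q))) (≤-reflexive (sym (opposite-prop zero)))))

-- Contractions of level orders in terms of initial segments

LevelOrder : ∀ {N} → (Fin N → ℕ) → Pred ℕ 0ℓ → Rel (Fin N) 0ℓ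
LevelOrder f H p q = p ≡ q ⊎ f p < f q ⊎ (f p ≡ f q × H (f p))

module _ {N : ℕ} (f g : Fin N → ℕ) where

  Monotone : Set
  Monotone = ∀ {p q} → g p < g q → f p ≤ f q

  -- Only sizes of initial segments occur, ready for comparison with partial sums. For monotone
  -- levels, `inside⇒≡` and `≡⇒inside` translate to actual containment of a level of `g` that has an
  -- element. Both indices are arbitrary naturals, so empty or nonexistent levels need no special
  -- treatment.
  Inside : ℕ → ℕ → Set
  Inside s j = # f below s ≤ # g below j × # g below suc j ≤ # f below suc s

  module _ (mono : Monotone) where

    mono′ : ∀ {p q} → f p < f q → g p ≤ g q
    mono′ fp<fq = ≮⇒≥ (λ gq<gp → <⇒≱ fp<fq (mono gq<gp))

    -- If `f p` were less than `s`, all elements below level `j` of `g` would lie below `s` in `f`,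
    -- and so would `p` in addition, against the first inequality. The case `s < f p` is dual and
    -- contradicts the second.
    inside⇒≡ : ∀ {s j p} → Inside s j → g p ≡ j → f p ≡ s
    inside⇒≡ {s} {j} {p} (lower , upper) refl with <-cmp (f p) s
    ... | tri≈ _ fp≡s _ = fp≡s
    ... | tri< fp<s _ _ = ⊥-elim (<⇒≱ (#-mono-< {f = g} {f}
            (λ gq<gp → ≤-<-trans (mono gq<gp) fp<s) ≤-refl fp<s) lower)
    ... | tri> _ _ s<fp = ⊥-elim (<⇒≱ (#-mono-< {f = f} {g}
            (λ fq≤s → s≤s (mono′ (≤-<-trans (s≤s⁻¹ fq≤s) s<fp))) s<fp ≤-refl) upper)

    ≡⇒inside : ∀ {s p} → (∀ {q} → g q ≡ g p → f q ≡ s) → Inside s (g p)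
    ≡⇒inside {s} {p} same = #-mono-≤ {f = f} {g} lower , #-mono-≤ {f = g} {f} upper
      where
      lower : ∀ {q} → f q < s → g q < g p
      lower fq<s = ≤∧≢⇒< (mono′ (<-≤-trans fq<s (≤-reflexive (sym (same refl)))))
                         (λ gq≡gp → <⇒≢ fq<s (same gq≡gp))
      upper : ∀ {q} → g q < suc (g p) → f q < suc s
      upper {q} gq≤gp with m≤n⇒m<n∨m≡n (s≤s⁻¹ gq≤gp)
      ... | inj₁ gq<gp = s≤s (≤-trans (mono gq<gp) (≤-reflexive (same refl)))
      ... | inj₂ gq≡gp = s≤s (≤-reflexive (same gq≡gp))

record Refines {N : ℕ} (f g : Fin N → ℕ) (H : Pred ℕ 0ℓ) : Set where
  field
    antichain-inside    : ∀ p → ¬ H (g p) → ∃[ s ] Inside f g s (g p)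
    class-crosses       : ∀ p → H (g p) → ∀ s → ¬ Inside f g s (g p)
    antichains-separate : ∀ p q s → ¬ H (g p) → ¬ H (g q) →
                          Inside f g s (g p) → Inside f g s (g q) → g p ≡ g q

-- A one-element class would lie in a single level of `f` and spoil `class-crosses`; `g-classes`
-- excludes it. The hypothesis `f-antichains` concerns levels of elements only, because an empty
-- block may well be labelled homogeneous.
module Levels {N : ℕ} {f g : Fin N → ℕ} {E H : Pred ℕ 0ℓ} (H? : Decidable H)
              (f-antichains : ∀ p → ¬ E (f p))
              (g-classes : ∀ p → H (g p) → ∃[ q ] (q ≢ p × g q ≡ g p))
              {R S : Rel (Fin N) 0ℓ}
              (R⇔ : R ⇔ᴿ LevelOrder f E) (S⇔ : S ⇔ᴿ LevelOrder g H)
  where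

  R⇒ : ∀ {p q} → R p q → p ≡ q ⊎ f p < f q
  R⇒ r with proj₁ R⇔ r
  ... | inj₁ p≡q             = inj₁ p≡q
  ... | inj₂ (inj₁ fp<fq)    = inj₂ fp<fq
  ... | inj₂ (inj₂ (_ , e))  = ⊥-elim (f-antichains _ e)

  <⇒R : ∀ {p q} → f p < f q → R p q
  <⇒R fp<fq = proj₂ R⇔ (inj₂ (inj₁ fp<fq))

  R-refl : Reflexive R
  R-refl = proj₂ R⇔ (inj₁ refl)

  R-trans : Transitive R
  R-trans r r′ with R⇒ r | R⇒ r′
  ... | inj₁ refl  | _           = r′
  ... | inj₂ fp<fq | inj₁ refl   = r
  ... | inj₂ fp<fq | inj₂ fq<fr  = <⇒R (<-trans fp<fq fq<fr)

  R? : Decidable₂ R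
  R? p q with p ≟ᶠ q ⊎-dec f p <? f q
  ... | yes (inj₁ refl)  = yes R-refl
  ... | yes (inj₂ fp<fq) = yes (<⇒R fp<fq)
  ... | no ≰             = no (≰ ∘ R⇒)

  <⇒S : ∀ {p q} → g p < g q → S p q
  <⇒S gp<gq = proj₂ S⇔ (inj₂ (inj₁ gp<gq))

  class⇒S : ∀ {p q} → g p ≡ g q → H (g p) → S p q
  class⇒S gp≡gq h = proj₂ S⇔ (inj₂ (inj₂ (gp≡gq , h)))

  S-trans : Transitive S
  S-trans s s′ with proj₁ S⇔ s | proj₁ S⇔ s′
  ... | inj₁ refl               | _                          = s′
  ... | inj₂ _                  | inj₁ refl                  = s
  ... | inj₂ (inj₁ a)           | inj₂ (inj₁ b)              = <⇒S (<-trans a b)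
  ... | inj₂ (inj₁ a)           | inj₂ (inj₂ (b , _))        = <⇒S (<-≤-trans a (≤-reflexive b))
  ... | inj₂ (inj₂ (a , _))     | inj₂ (inj₁ b)              = <⇒S (≤-<-trans (≤-reflexive a) b)
  ... | inj₂ (inj₂ (a , h))     | inj₂ (inj₂ (b , _))        = class⇒S (trans a b) h

  S? : Decidable₂ S
  S? p q with p ≟ᶠ q ⊎-dec g p <? g q ⊎-dec (g p ≟ g q ×-dec H? (g p))
  ... | yes s = yes (proj₂ S⇔ s)
  ... | no ≰  = no (≰ ∘ proj₁ S⇔)

  S⇒≤ : ∀ {p q} → S p q → g p ≤ g q
  S⇒≤ s with proj₁ S⇔ s
  ... | inj₁ refl                = ≤-refl
  ... | inj₂ (inj₁ gp<gq)        = <⇒≤ gp<gq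
  ... | inj₂ (inj₂ (gp≡gq , _))  = ≤-reflexive gp≡gq

  S-antichain : ∀ {p q} → S p q → g p ≡ g q → ¬ H (g p) → p ≡ q
  S-antichain s gp≡gq ¬h with proj₁ S⇔ s
  ... | inj₁ p≡q             = p≡q
  ... | inj₂ (inj₁ gp<gq)    = ⊥-elim (<⇒≢ gp<gq gp≡gq)
  ... | inj₂ (inj₂ (_ , h))  = ⊥-elim (¬h h)

  contraction⇒ : S IsPreorderContractionOf R → (R ⇒ S) × Refines f g H
  contraction⇒ (T , steps , T⇒S , S⇒T) = R⇒S , record
      { antichain-inside    = antichain-inside
      ; class-crosses       = λ p h s ins → class-crosses p h
          (λ {q} gq≡gp → trans (inside⇒≡ f g mono ins gq≡gp) (sym (inside⇒≡ f g mono ins refl)))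
      ; antichains-separate = λ p q s ¬hp ¬hq insp insq → antichains-separate ¬hp ¬hq
          (trans (inside⇒≡ f g mono insp refl) (sym (inside⇒≡ f g mono insq refl)))
      }
    where
    T-trans : Transitive T
    T-trans t t′ = S⇒T (S-trans (T⇒S t) (T⇒S t′))

    R⇒S : R ⇒ S
    R⇒S r = T⇒S (proj₁ (contraction⇒unfold T-trans steps) r)

    S⇒unfold : S ⇒ TransClosure (Unfold R T)
    S⇒unfold s = proj₂ (contraction⇒unfold T-trans steps) (S⇒T s)

    mono : Monotone f g
    mono gp<gq = ≮⇒≥ (λ fq<fp → <⇒≱ gp<gq (S⇒≤ (R⇒S (<⇒R fq<fp))))

    antichain-inside : ∀ p → ¬ H (g p) → ∃[ s ] Inside f g s (g p)
    antichain-inside p ¬h = f p , ≡⇒inside f g mono same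
      where
      same : ∀ {q} → g q ≡ g p → f q ≡ f p
      same {q} gq≡gp with <-cmp (f q) (f p)
      ... | tri≈ _ eq _ = eq
      ... | tri< fq<fp _ _ =
              cong f (S-antichain (R⇒S (<⇒R fq<fp)) gq≡gp (¬h ∘ subst H gq≡gp))
      ... | tri> _ _ fp<fq = sym (cong f (S-antichain (R⇒S (<⇒R fp<fq)) (sym gq≡gp) ¬h))

    unfold⇒S : ∀ {p q} → TransClosure (Unfold R T) p q → S p q
    unfold⇒S [ forth r ]     = R⇒S r
    unfold⇒S [ back _ t ]    = T⇒S t
    unfold⇒S (forth r ∷ c)   = S-trans (R⇒S r) (unfold⇒S c)
    unfold⇒S (back _ t ∷ c)  = S-trans (T⇒S t) (unfold⇒S c)

    -- Suppose the class lies in one level of `f`. Distinct elements of one level are unrelated in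
    -- `R`, so an unfolding step inside the class is trivial. A path between two members cannot
    -- leave the class, since `S` squeezes the level of each intermediate point. The path to a
    -- second member would thus be constant.
    class-crosses : ∀ p → H (g p) → ¬ (∀ {q} → g q ≡ g p → f q ≡ f p)
    class-crosses p h same with q , q≢p , gq≡gp ← g-classes p h =
      q≢p (sym (stuck (S⇒unfold (class⇒S (sym gq≡gp) h)) refl gq≡gp))
      where
      stuck₁ : ∀ {x y} → Unfold R T x y → g x ≡ g p → g y ≡ g p → x ≡ y
      stuck₁ (forth r) gx gy with R⇒ r
      ... | inj₁ x≡y   = x≡y
      ... | inj₂ fx<fy = ⊥-elim (<⇒≢ fx<fy (trans (same gx) (sym (same gy))))
      stuck₁ (back r _) gx gy with R⇒ r
      ... | inj₁ y≡x   = sym y≡x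
      ... | inj₂ fy<fx = ⊥-elim (<⇒≢ fy<fx (trans (same gy) (sym (same gx))))

      stuck : ∀ {x y} → TransClosure (Unfold R T) x y → g x ≡ g p → g y ≡ g p → x ≡ y
      stuck [ u ] gx gy = stuck₁ u gx gy
      stuck {x} {y} (_∷_ {y = z} u c) gx gy =
        trans (stuck₁ u gx gz) (stuck c gz gy)
        where
        gz : g z ≡ g p
        gz = ≤-antisym (≤-trans (S⇒≤ (unfold⇒S c)) (≤-reflexive gy))
                       (≤-trans (≤-reflexive (sym gx)) (S⇒≤ (unfold⇒S [ u ])))

    -- A path leaving p must first go up in R, beyond the level of q.
    no-path : ∀ {p q} → ¬ H (g p) → ¬ H (g q) → f p ≡ f q → g p ≢ g q →
              ¬ TransClosure (Unfold R T) p q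
    no-path ¬hp ¬hq fp≡fq gp≢gq path = gp≢gq (cong g (go path ¬hp ¬hq fp≡fq))
      where
      -- Being lower in `f`, `y` precedes `z` in `S`, while the rest of the path gives the opposite
      -- relation. As `y` lies in an antichain block, this would force `y ≡ z`.
      above : ∀ {x z y} → f x < f z → f x ≡ f y → S z y → ¬ H (g y) → x ≡ y
      above fx<fz fx≡fy Szy ¬hy = ⊥-elim (<⇒≢ fy<fz (cong f y≡z))
        where
        fy<fz = ≤-<-trans (≤-reflexive (sym fx≡fy)) fx<fz
        Syz   = R⇒S (<⇒R fy<fz)
        y≡z   = S-antichain Syz (≤-antisym (S⇒≤ Syz) (S⇒≤ Szy)) ¬hy

      first : ∀ {x z} → Unfold R T x z → ¬ H (g x) → x ≡ z ⊎ f x < f z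
      first (forth r) _ = R⇒ r
      first (back r t) ¬hx with R⇒S r | T⇒S t
      ... | Szx | Sxz = inj₁ (S-antichain Sxz (≤-antisym (S⇒≤ Sxz) (S⇒≤ Szx)) ¬hx)

      go : ∀ {x y} → TransClosure (Unfold R T) x y → ¬ H (g x) → ¬ H (g y) → f x ≡ f y → x ≡ y
      go [ u ] ¬hx ¬hy fx≡fy with first u ¬hx
      ... | inj₁ x≡y   = x≡y
      ... | inj₂ fx<fy = ⊥-elim (<⇒≢ fx<fy fx≡fy)
      go (u ∷ c) ¬hx ¬hy fx≡fy with first u ¬hx
      ... | inj₁ refl  = go c ¬hx ¬hy fx≡fy
      ... | inj₂ fx<fz = above fx<fz fx≡fy (unfold⇒S c) ¬hy

    antichains-separate : ∀ {p q} → ¬ H (g p) → ¬ H (g q) → f p ≡ f q → g p ≡ g q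
    antichains-separate {p} {q} ¬hp ¬hq fp≡fq with <-cmp (g p) (g q)
    ... | tri≈ _ gp≡gq _ = gp≡gq
    ... | tri< gp<gq _ _ = ⊥-elim (no-path ¬hp ¬hq fp≡fq (<⇒≢ gp<gq) (S⇒unfold (<⇒S gp<gq)))
    ... | tri> _ _ gq<gp = ⊥-elim (no-path ¬hq ¬hp (sym fp≡fq) (<⇒≢ gq<gp) (S⇒unfold (<⇒S gq<gp)))

  ⇒contraction : Monotone f g → Refines f g H → S IsPreorderContractionOf R
  ⇒contraction mono refines = unfold⇒contraction S-trans S? R-refl R-trans R? R⇒S S⇒unfold
    where
    open Refines refines

    R⇒S : R ⇒ S
    R⇒S {p} {q} r with R⇒ r
    ... | inj₁ refl = proj₂ S⇔ (inj₁ refl)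
    ... | inj₂ fp<fq with m≤n⇒m<n∨m≡n (mono′ f g mono fp<fq) | H? (g p)
    ...   | inj₁ gp<gq | _      = <⇒S gp<gq
    ...   | inj₂ gp≡gq | yes h  = class⇒S gp≡gq h
    ...   | inj₂ gp≡gq | no ¬h with _ , ins ← antichain-inside p ¬h =
              ⊥-elim (<⇒≢ fp<fq (trans (inside⇒≡ f g mono ins refl)
                                       (sym (inside⇒≡ f g mono ins (sym gp≡gq)))))

    escape : ∀ p → H (g p) → ∃[ q ] (g q ≡ g p × f q ≢ f p)
    escape p h with any? (λ q → g q ≟ g p ×-dec ¬? (f q ≟ f p))
    ... | yes found = found
    ... | no ∄q = ⊥-elim (class-crosses p h (f p) (≡⇒inside f g mono
            λ {q} gq≡gp → decidable-stable (f q ≟ f p) λ fq≢fp → ∄q (q , gq≡gp , fq≢fp)))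

    within : ∀ {p q} → g p ≡ g q → H (g p) → f p ≢ f q → Unfold R S p q
    within {p} {q} gp≡gq h fp≢fq with <-cmp (f p) (f q)
    ... | tri< fp<fq _ _ = forth (<⇒R fp<fq)
    ... | tri≈ _ fp≡fq _ = ⊥-elim (fp≢fq fp≡fq)
    ... | tri> _ _ fq<fp = back (<⇒R fq<fp) (class⇒S gp≡gq h)

    up : ∀ {p q} → g p < g q → f p ≢ f q → Unfold R S p q
    up gp<gq fp≢fq = forth (<⇒R (≤∧≢⇒< (mono gp<gq) fp≢fq))

    -- The only difficult pairs share a level of `f`, where `R` has no step between distinct
    -- elements. If one of their blocks is a class, `escape` yields a member on another level and
    -- hence a detour of two steps. Two antichain blocks in one level coincide, so they cannot be
    -- strictly ordered.
    S⇒unfold : S ⇒ TransClosure (Unfold R S)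
    S⇒unfold {p} {q} s with proj₁ S⇔ s | f p ≟ f q
    ... | inj₁ refl               | _        = [ forth R-refl ]
    ... | inj₂ (inj₁ gp<gq)       | no fp≢fq = [ up gp<gq fp≢fq ]
    ... | inj₂ (inj₂ (gp≡gq , h)) | no fp≢fq = [ within gp≡gq h fp≢fq ]
    ... | inj₂ (inj₂ (gp≡gq , h)) | yes fp≡fq with r , gr≡gp , fr≢fp ← escape p h =
            within (sym gr≡gp) h (fr≢fp ∘ sym) ∷
            [ within (trans gr≡gp gp≡gq) (subst H (sym gr≡gp) h) (λ fr≡fq → fr≢fp (trans fr≡fq (sym fp≡fq))) ]
    S⇒unfold {p} {q} s | inj₂ (inj₁ gp<gq) | yes fp≡fq with H? (g p) | H? (g q)
    ... | yes h | _ with r , gr≡gp , fr≢fp ← escape p h =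
            within (sym gr≡gp) h (fr≢fp ∘ sym) ∷
            [ up (≤-<-trans (≤-reflexive gr≡gp) gp<gq) (λ fr≡fq → fr≢fp (trans fr≡fq (sym fp≡fq))) ]
    ... | no _ | yes h with r , gr≡gq , fr≢fq ← escape q h =
            up (<-≤-trans gp<gq (≤-reflexive (sym gr≡gq))) (λ fp≡fr → fr≢fq (trans (sym fp≡fr) fp≡fq)) ∷
            [ within gr≡gq (subst H (sym gr≡gq) h) fr≢fq ]
    ... | no ¬hp | no ¬hq with s , insp ← antichain-inside p ¬hp | t , insq ← antichain-inside q ¬hq =
            ⊥-elim (<⇒≢ gp<gq (antichains-separate p q s ¬hp ¬hq insp
              (subst (λ t → Inside f g t (g q)) (trans (sym (inside⇒≡ f g mono insq refl))
                 (trans (sym fp≡fq) (inside⇒≡ f g mono insp refl))) insq)))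

-- Skewed binary partitions

-- Here `C` stands for the counting function of a partition, with block sizes `h`. Its constancy
-- from `K` on matches `take` running past the end of the list.
sum-take-tabulate : ∀ {K} (h : Fin K → ℕ) (C : ℕ → ℕ) →
                    (∀ i → C (suc (toℕ i)) ≡ C (toℕ i) + h i) → (∀ s → K ≤ s → C s ≡ C K) →
                    ∀ s → C s ≡ C 0 + sum (take s (toList (tabulate h)))
sum-take-tabulate {zero} h C step const s = begin
  C s                     ≡⟨ const s z≤n ⟩
  C 0                     ≡⟨ +-identityʳ _ ⟨
  C 0 + 0                 ≡⟨ cong (λ xs → C 0 + sum xs) (take-[] s) ⟨
  C 0 + sum (take s [])   ∎
  where open ≡-Reasoning
sum-take-tabulate {suc K} h C step const zero    = sym (+-identityʳ _)
sum-take-tabulate {suc K} h C step const (suc s) = begin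
  C (suc s)         ≡⟨ sum-take-tabulate (h ∘ suc) (C ∘ suc) (step ∘ suc) (λ s K≤s → const (suc s) (s≤s K≤s)) s ⟩
  C 1 + σ           ≡⟨ cong (_+ σ) (step zero) ⟩
  C 0 + h zero + σ  ≡⟨ +-assoc (C 0) _ _ ⟩
  C 0 + (h zero + σ) ∎
  where
  open ≡-Reasoning
  σ = sum (take s (toList (tabulate (h ∘ suc))))

map-take-tabulate : ∀ {A B : Set} (e : A → B) {K} (g : Fin K → A) (h : Fin K → B) → (∀ i → e (g i) ≡ h i) →
                    ∀ j → map e (take j (toList (tabulate g))) ≡ take j (toList (tabulate h))
map-take-tabulate e {zero}  g h eq j       = trans (cong (map e) (take-[] j)) (sym (take-[] j))
map-take-tabulate e {suc K} g h eq zero    = refl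
map-take-tabulate e {suc K} g h eq (suc j) =
  cong₂ _∷_ (eq zero) (map-take-tabulate e (g ∘ suc) (h ∘ suc) (eq ∘ suc) j)

x∈p⇒0<∣p∣ : ∀ {N} {x : Fin N} {p : Subset N} → x ∈ p → 0 < ∣ p ∣
x∈p⇒0<∣p∣ x∈p = ≤-<-trans z≤n (x∈p⇒∣p-x∣<∣p∣ x∈p)

Empty⇒∣p∣≡0 : ∀ {N} {p : Subset N} → Empty p → ∣ p ∣ ≡ 0
Empty⇒∣p∣≡0 {N} empty = trans (cong ∣_∣ (Empty-unique empty)) (∣⊥∣≡0 N)

0<∣p∣⇒Nonempty : ∀ {N} {p : Subset N} → 0 < ∣ p ∣ → Nonempty p
0<∣p∣⇒Nonempty {p = p} 0<∣p∣ with nonempty? p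
... | yes ne = ne
... | no ¬ne = ⊥-elim (<⇒≢ 0<∣p∣ (sym (Empty⇒∣p∣≡0 ¬ne)))

homogeneous≢nonHomogeneous : homogeneous ≢ nonHomogeneous
homogeneous≢nonHomogeneous ()

¬homogeneous⇒nonHomogeneous : ∀ {l} → l ≢ homogeneous → l ≡ nonHomogeneous
¬homogeneous⇒nonHomogeneous {homogeneous}    ≢hom = ⊥-elim (≢hom refl)
¬homogeneous⇒nonHomogeneous {nonHomogeneous} _    = refl

module Partition {n : ℕ} (X : SkewedBinaryPartition n) where
  open SkewedBinaryPartition X

  level : Fin (suc n) → ℕ
  level p = toℕ (proj₁ (covering p))

  C : ℕ → ℕ
  C = # level below_

  ∈⇒level : ∀ {p i} → p ∈ block i → level p ≡ toℕ i
  ∈⇒level p∈ = cong toℕ (disjoint (proj₂ (covering _)) p∈)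

  level⇒∈ : ∀ {p i} → level p ≡ toℕ i → p ∈ block i
  level⇒∈ {p} eq = subst (λ i → p ∈ block i) (toℕ-injective eq) (proj₂ (covering p))

  ∣block∣ : ∀ i → ∣ block i ∣ ≡ ∣ comprehension (λ p → level p ≟ toℕ i) ∣
  ∣block∣ i = ≤-antisym
    (p⊆q⇒∣p∣≤∣q∣ {p = block i} (∈-comprehension⁺ (λ p → level p ≟ toℕ i) ∘ ∈⇒level))
    (p⊆q⇒∣p∣≤∣q∣ {q = block i} (level⇒∈ ∘ ∈-comprehension⁻ (λ p → level p ≟ toℕ i)))

  C-suc : ∀ i → C (suc (toℕ i)) ≡ C (toℕ i) + ∣ block i ∣
  C-suc i = trans (#-suc level (toℕ i)) (cong (C (toℕ i) +_) (sym (∣block∣ i)))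

  C-mono : ∀ {s t} → s ≤ t → C s ≤ C t
  C-mono = #-monoʳ-≤ level

  C-const : ∀ s → 2 + k ≤ s → C s ≡ suc n
  C-const s K≤s = #-full level (λ p → <-≤-trans (toℕ<n (proj₁ (covering p))) K≤s)

  C-0 : C 0 ≡ 0
  C-0 = #-zero level

  C-1 : C 1 ≡ ∣ B₋₁ ∣
  C-1 = trans (C-suc zero) (cong (_+ ∣ B₋₁ ∣) C-0)

  C-2 : C 2 ≡ ∣ B₋₁ ∣ + ∣ B₀ ∣
  C-2 = trans (C-suc (suc zero)) (cong (_+ ∣ B₀ ∣) C-1)

  tailEntry : Fin k → Entry
  tailEntry i = decorate X (label (suc (suc i))) ∣ block (suc (suc i)) ∣

  ∣tailEntry∣ : ∀ i → ∣ tailEntry i ∣ₑ ≡ ∣ block (suc (suc i)) ∣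
  ∣tailEntry∣ i with label (suc (suc i))
  ... | homogeneous    = refl
  ... | nonHomogeneous = refl

  -- Matching on this through `type-shape` replaces abstraction over the test `zero ∈? B₀` inside
  -- `type`, and supplies the size and level facts of each case at once.
  data Head : Entry → Entry → Set where
    0∈B₀ : zero ∈ B₀ → 1 ≤ ∣ B₀ ∣ → level zero ≡ 1 →
           Head (plain ∣ B₋₁ ∣) ((∣ B₀ ∣ ∸ 1) °)
    0∉B₀ : ¬ zero ∈ B₀ → 2 ≤ ∣ B₋₁ ∣ → ∣ B₀ ∣ ≡ 0 → level zero ≡ 0 →
           Head (plain (∣ B₋₁ ∣ ∸ 1)) (plain 0)

  type-shape : ∃[ e ] ∃[ e′ ] (Head e e′ × type X ≡ e ∷ᵛ e′ ∷ᵛ tabulate tailEntry)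
  type-shape with zero ∈? B₀
  ... | yes 0∈ = _ , _ , 0∈B₀ 0∈ (x∈p⇒0<∣p∣ 0∈) (∈⇒level 0∈) , refl
  ... | no 0∉ with 0∈B₋₁∪B₀
  ...   | inj₂ 0∈ = ⊥-elim (0∉ 0∈)
  ...   | inj₁ 0∈ = _ , _ , 0∉B₀ 0∉ (proj₁ (0∈B₋₁⇒ 0∈)) (Empty⇒∣p∣≡0 (proj₂ (0∈B₋₁⇒ 0∈))) (∈⇒level 0∈) , refl

  head-sum : ∀ {e e′} → Head e e′ → C 2 ≡ suc (∣ e ∣ₑ + ∣ e′ ∣ₑ)
  head-sum (0∈B₀ _ 1≤ _) = trans C-2 (trans (cong (∣ B₋₁ ∣ +_) (sym (m+[n∸m]≡n 1≤))) (+-suc _ _))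
  head-sum (0∉B₀ _ 2≤ ∣B₀∣≡0 _) = begin
    C 2                          ≡⟨ C-2 ⟩
    ∣ B₋₁ ∣ + ∣ B₀ ∣             ≡⟨ cong₂ _+_ (sym (m+[n∸m]≡n (<⇒≤ 2≤))) ∣B₀∣≡0 ⟩
    suc (∣ B₋₁ ∣ ∸ 1) + 0        ∎
    where open ≡-Reasoning

  -- The extra one is the element 0, which `type` subtracts from whichever of the first two blocks
  -- contains it. Beyond `k` both sides are constant.
  C-S : ∀ j → C (2 + j) ≡ suc (S (type X) j)
  C-S j with e , e′ , head , eq ← type-shape = begin
    C (2 + j)
      ≡⟨ sum-take-tabulate h (C ∘ (2 +_)) (λ i → C-suc (suc (suc i))) const j ⟩
    C 2 + sum (take j (toList (tabulate h)))
      ≡⟨ cong₂ _+_ (head-sum head) (cong sum (sym (map-take-tabulate ∣_∣ₑ tailEntry h ∣tailEntry∣ j))) ⟩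
    suc (∣ e ∣ₑ + ∣ e′ ∣ₑ + σ)
      ≡⟨ cong suc (+-assoc ∣ e ∣ₑ _ _) ⟩
    suc (∣ e ∣ₑ + (∣ e′ ∣ₑ + σ))
      ≡⟨ cong (λ b → suc (S b j)) eq ⟨
    suc (S (type X) j) ∎
    where
    open ≡-Reasoning
    h : Fin k → ℕ
    h i = ∣ block (suc (suc i)) ∣
    σ = sum (map ∣_∣ₑ (take j (toList (tabulate tailEntry))))
    const : ∀ s → k ≤ s → C (2 + s) ≡ C (2 + k)
    const s k≤s = trans (C-const (2 + s) (s≤s (s≤s k≤s))) (sym (C-const (2 + k) ≤-refl))

  S-mono : ∀ {i j} → i ≤ j → S (type X) i ≤ S (type X) j
  S-mono {i} {j} i≤j = s≤s⁻¹ (begin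
    suc (S (type X) i)  ≡⟨ C-S i ⟨
    C (2 + i)           ≤⟨ C-mono (+-monoʳ-≤ 2 i≤j) ⟩
    C (2 + j)           ≡⟨ C-S j ⟩
    suc (S (type X) j)  ∎)
    where open ≤-Reasoning

  S≤n : ∀ j → S (type X) j ≤ n
  S≤n j = s≤s⁻¹ (≤-trans (≤-reflexive (sym (C-S j))) (#≤N level (2 + j)))

  C-< : ∀ i → Nonempty (block i) → C (toℕ i) < C (suc (toℕ i))
  C-< i (p , p∈) = <-≤-trans (m<m+n (C (toℕ i)) (x∈p⇒0<∣p∣ p∈)) (≤-reflexive (sym (C-suc i)))

  S-< : ∀ (j : Fin k) → S (type X) (toℕ j) < S (type X) (suc (toℕ j))
  S-< j = s<s⁻¹ (begin-strict
    suc (S (type X) (toℕ j))        ≡⟨ C-S (toℕ j) ⟨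
    C (2 + toℕ j)                   <⟨ C-< (suc (suc j)) (nonempty j) ⟩
    C (3 + toℕ j)                   ≡⟨ C-S (suc (toℕ j)) ⟩
    suc (S (type X) (suc (toℕ j)))  ∎)
    where open ≤-Reasoning

  lookup-tail : ∀ i → lookup (type X) (suc (suc i)) ≡ tailEntry i
  lookup-tail i with e , e′ , _ , eq ← type-shape =
    trans (cong (λ b → lookup b (suc (suc i))) eq) (lookup∘tabulate tailEntry i)

  lookup-B₀ : (lookup (type X) (suc zero) ≡ plain 0 × ¬ zero ∈ B₀ × 2 ≤ ∣ B₋₁ ∣ × ∣ B₀ ∣ ≡ 0)
            ⊎ (lookup (type X) (suc zero) ≢ plain 0 × zero ∈ B₀ × 1 ≤ ∣ B₀ ∣ × level zero ≡ 1)
  lookup-B₀ with type-shape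
  ... | _ , _ , 0∈B₀ 0∈ 1≤ l≡1 , eq =
          inj₂ ((λ eq′ → case trans (sym (cong (λ b → lookup b (suc zero)) eq)) eq′ of λ ()) , 0∈ , 1≤ , l≡1)
  ... | _ , _ , 0∉B₀ 0∉ 2≤ ≡0 _ , eq = inj₁ (cong (λ b → lookup b (suc zero)) eq , 0∉ , 2≤ , ≡0)

  level-0≤1 : level zero ≤ 1
  level-0≤1 with 0∈B₋₁∪B₀
  ... | inj₁ 0∈ = ≤-trans (≤-reflexive (∈⇒level 0∈)) z≤n
  ... | inj₂ 0∈ = ≤-reflexive (∈⇒level 0∈)

  IsHomogeneous : ℕ → Set
  IsHomogeneous s = ∃[ i ] (toℕ i ≡ s × label i ≡ homogeneous)

  homogeneous? : ∀ l → Dec (l ≡ homogeneous)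
  homogeneous? homogeneous    = yes refl
  homogeneous? nonHomogeneous = no λ ()

  isHomogeneous? : Decidable IsHomogeneous
  isHomogeneous? s = any? (λ i → toℕ i ≟ s ×-dec homogeneous? (label i))

  IsHomogeneous⇒label : ∀ {i} → IsHomogeneous (toℕ i) → label i ≡ homogeneous
  IsHomogeneous⇒label (i , i≡ , hom) with refl ← toℕ-injective i≡ = hom

  ≼⇔LevelOrder : _≼_ ⇔ᴿ LevelOrder level IsHomogeneous
  ≼⇔LevelOrder = to , from
    where
    to : ∀ {p q} → p ≼ q → LevelOrder level IsHomogeneous p q
    to (inj₁ p≡q) = inj₁ p≡q
    to (inj₂ (inj₁ (i , j , i<j , p∈ , q∈))) = inj₂ (inj₁
      (≤-<-trans (≤-reflexive (∈⇒level p∈)) (<-≤-trans i<j (≤-reflexive (sym (∈⇒level q∈))))))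
    to (inj₂ (inj₂ (i , hom , p∈ , q∈))) = inj₂ (inj₂
      (trans (∈⇒level p∈) (sym (∈⇒level q∈)) , i , sym (∈⇒level p∈) , hom))
    from : ∀ {p q} → LevelOrder level IsHomogeneous p q → p ≼ q
    from (inj₁ p≡q) = inj₁ p≡q
    from (inj₂ (inj₁ p<q)) = inj₂ (inj₁ (_ , _ , p<q , proj₂ (covering _) , proj₂ (covering _)))
    from (inj₂ (inj₂ (p≡q , i , i≡ , hom))) = inj₂ (inj₂
      (i , hom , level⇒∈ (sym i≡) , level⇒∈ (sym (trans i≡ p≡q))))

  class-not-singleton : ∀ p → IsHomogeneous (level p) → ∃[ q ] (q ≢ p × level q ≡ level p)
  class-not-singleton p (zero , _ , hom) =
    ⊥-elim (homogeneous≢nonHomogeneous (trans (sym hom) B₋₁-nonHomogeneous))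
  class-not-singleton p (suc i , i≡ , hom) with any? (λ q → ¬? (q ≟ᶠ p) ×-dec level q ≟ level p)
  ... | yes found = found
  ... | no ∄q = ⊥-elim (homogeneous≢nonHomogeneous (trans (sym hom) (singleton i (≤-antisym
          (≤-trans (p⊆q⇒∣p∣≤∣q∣ {p = block (suc i)} {q = ⁅ p ⁆} block⊆) (≤-reflexive (∣⁅x⁆∣≡1 p)))
          (x∈p⇒0<∣p∣ {p = block (suc i)} (level⇒∈ (sym i≡)))))))
    where
    block⊆ : ∀ {q} → q ∈ block (suc i) → q ∈ ⁅ p ⁆
    block⊆ {q} q∈ with q ≟ᶠ p
    ... | yes refl = x∈⁅x⁆ p
    ... | no q≢p   = ⊥-elim (∄q (q , q≢p , trans (∈⇒level q∈) i≡))

-- Cutting a listing into blocks of prescribed sizes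

segment : (bs : List ℕ) (x : ℕ) → x < sum bs → Fin (length bs)
segment (b ∷ bs) x x<Σ with x <? b
... | yes _   = zero
... | no  x≮b = suc (segment bs (x ∸ b) (+-cancelˡ-< b _ _
                  (≤-<-trans (≤-reflexive (m+[n∸m]≡n (≮⇒≥ x≮b))) x<Σ)))

segment-<⁻ : ∀ bs {x} (x<Σ : x < sum bs) {s} → toℕ (segment bs x x<Σ) < s → x < sum (take s bs)
segment-<⁻ (b ∷ bs) {x} x<Σ {suc s} lt with x <? b
... | yes x<b = <-≤-trans x<b (m≤m+n b _)
... | no x≮b  = ≤-<-trans (≤-reflexive (sym (m+[n∸m]≡n (≮⇒≥ x≮b))))
                          (+-monoʳ-< b (segment-<⁻ bs _ (s<s⁻¹ lt)))

segment-<⁺ : ∀ bs {x} (x<Σ : x < sum bs) {s} → x < sum (take s bs) → toℕ (segment bs x x<Σ) < s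
segment-<⁺ (b ∷ bs) {x} x<Σ {suc s} lt with x <? b
... | yes x<b = s≤s z≤n
... | no x≮b  = s≤s (segment-<⁺ bs _ (+-cancelˡ-< b _ _
                  (≤-<-trans (≤-reflexive (m+[n∸m]≡n (≮⇒≥ x≮b))) lt)))

sum-take-suc : ∀ bs i → sum (take (suc (toℕ i)) bs) ≡ sum (take (toℕ i) bs) + List.lookup bs i
sum-take-suc (b ∷ bs) zero    = +-identityʳ b
sum-take-suc (b ∷ bs) (suc i) =
  trans (cong (b +_) (sum-take-suc bs i)) (sym (+-assoc b _ _))

sum-take-≤ : ∀ s bs → sum (take s bs) ≤ sum bs
sum-take-≤ zero    bs       = z≤n
sum-take-≤ (suc s) []       = z≤n
sum-take-≤ (suc s) (b ∷ bs) = +-monoʳ-≤ b (sum-take-≤ s bs)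

toList-tabulate-lookup : ∀ {A : Set} (e : ℕ → A) cs (g : Fin (length cs) → A) →
                         (∀ i → g i ≡ e (List.lookup cs i)) → toList (tabulate g) ≡ map e cs
toList-tabulate-lookup e []       g eq = refl
toList-tabulate-lookup e (c ∷ cs) g eq = cong₂ _∷_ (eq zero) (toList-tabulate-lookup e cs (g ∘ suc) (eq ∘ suc))

-- The skewed binary partition with only non-homogeneous blocks, of cardinalities
-- a , b , cs, which cuts the listing r of [0,n] into consecutive segments.
module Cut {n : ℕ} (r : Fin (suc n) → ℕ) (r<1+n : ∀ p → r p < suc n)
           (#-r : ∀ {s} → s ≤ suc n → # r below s ≡ s)
           (a b : ℕ) (cs : List ℕ) (Σ≡ : sum (a ∷ b ∷ cs) ≡ suc n)
           (cs-positive : All (1 ≤_) cs) (b≤1 : b ≤ 1)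
           (0-low : r zero < a + b) (0-lowest : r zero < a → 2 ≤ a × b ≡ 0)
  where

  bs : List ℕ
  bs = a ∷ b ∷ cs

  r<Σ : ∀ p → r p < sum bs
  r<Σ p = <-≤-trans (r<1+n p) (≤-reflexive (sym Σ≡))

  f : Fin (suc n) → Fin (2 + length cs)
  f p = segment bs (r p) (r<Σ p)

  f<⇒r< : ∀ {p s} → toℕ (f p) < s → r p < sum (take s bs)
  f<⇒r< {p} = segment-<⁻ bs (r<Σ p)

  r<⇒f< : ∀ {p s} → r p < sum (take s bs) → toℕ (f p) < s
  r<⇒f< {p} = segment-<⁺ bs (r<Σ p)

  #-f : ∀ s → # (toℕ ∘ f) below s ≡ sum (take s bs)
  #-f s = trans
    (≤-antisym (#-mono-≤ {f = toℕ ∘ f} {r} {s} {sum (take s bs)} f<⇒r<)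
               (#-mono-≤ {f = r} {toℕ ∘ f} {sum (take s bs)} {s} r<⇒f<))
    (#-r (≤-trans (sum-take-≤ s bs) (≤-reflexive Σ≡)))

  f-mono : ∀ {p q} → r p ≤ r q → toℕ (f p) ≤ toℕ (f q)
  f-mono {p} {q} rp≤rq = ≮⇒≥ (λ fq<fp → <-irrefl refl (r<⇒f< {p} (≤-<-trans rp≤rq (f<⇒r< {q} fq<fp))))

  fibre : Fin (2 + length cs) → Subset (suc n)
  fibre i = comprehension (λ p → f p ≟ᶠ i)

  ∈-fibre⁺ : ∀ {p i} → f p ≡ i → p ∈ fibre i
  ∈-fibre⁺ {i = i} = ∈-comprehension⁺ (λ p → f p ≟ᶠ i)

  ∈-fibre⁻ : ∀ {p i} → p ∈ fibre i → f p ≡ i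
  ∈-fibre⁻ {i = i} = ∈-comprehension⁻ (λ p → f p ≟ᶠ i)

  ∣fibre∣ : ∀ i → ∣ fibre i ∣ ≡ List.lookup bs i
  ∣fibre∣ i = +-cancelˡ-≡ (sum (take (toℕ i) bs)) _ _ (begin
    sum (take (toℕ i) bs) + ∣ fibre i ∣
      ≡⟨ cong₂ _+_ (sym (#-f (toℕ i))) (≤-antisym
           (comprehension-mono-≤ (λ p → f p ≟ᶠ i) (λ p → toℕ (f p) ≟ toℕ i) (cong toℕ))
           (comprehension-mono-≤ (λ p → toℕ (f p) ≟ toℕ i) (λ p → f p ≟ᶠ i) toℕ-injective)) ⟩
    # (toℕ ∘ f) below toℕ i + ∣ comprehension (λ p → toℕ (f p) ≟ toℕ i) ∣
      ≡⟨ #-suc (toℕ ∘ f) (toℕ i) ⟨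
    # (toℕ ∘ f) below suc (toℕ i)
      ≡⟨ #-f (suc (toℕ i)) ⟩
    sum (take (suc (toℕ i)) bs)
      ≡⟨ sum-take-suc bs i ⟩
    sum (take (toℕ i) bs) + List.lookup bs i ∎)
    where open ≡-Reasoning

  f0<2 : toℕ (f zero) < 2
  f0<2 = r<⇒f< (<-≤-trans 0-low (≤-reflexive (cong (a +_) (sym (+-identityʳ b)))))

  f0≡0⊎1 : f zero ≡ zero ⊎ f zero ≡ suc zero
  f0≡0⊎1 with f zero | f0<2
  ... | zero        | _                 = inj₁ refl
  ... | suc zero    | _                 = inj₂ refl
  ... | suc (suc _) | s≤s (s≤s ())

  f0≡0⇒r0<a : f zero ≡ zero → r zero < a
  f0≡0⇒r0<a eq = <-≤-trans (f<⇒r< {zero} (s≤s (≤-reflexive (cong toℕ eq)))) (≤-reflexive (+-identityʳ a))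

  r0<a⇒f0≡0 : r zero < a → f zero ≡ zero
  r0<a⇒f0≡0 r0<a = toℕ-injective (n<1⇒n≡0 (r<⇒f< {zero} (<-≤-trans r0<a (m≤m+n a 0))))

  partition : SkewedBinaryPartition n
  partition = record
    { k                  = length cs
    ; block              = fibre
    ; label              = λ _ → nonHomogeneous
    ; disjoint           = λ p∈ p∈′ → trans (sym (∈-fibre⁻ p∈)) (∈-fibre⁻ p∈′)
    ; covering           = λ p → f p , ∈-fibre⁺ refl
    ; B₋₁-nonHomogeneous = refl
    ; B₀-homogeneous     = λ 2≤∣B₀∣ → ⊥-elim (<⇒≱ 2≤∣B₀∣ (≤-trans (≤-reflexive (∣fibre∣ (suc zero))) b≤1))
    ; 0∈B₋₁∪B₀           = [ inj₁ ∘ ∈-fibre⁺ , inj₂ ∘ ∈-fibre⁺ ]′ f0≡0⊎1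
    ; 0∈B₋₁⇒             = λ 0∈ → lowest (0-lowest (f0≡0⇒r0<a (∈-fibre⁻ 0∈)))
    ; singleton          = λ _ _ → refl
    ; nonempty           = λ i → 0<∣p∣⇒Nonempty (≤-trans (All.lookup cs-positive (∈-lookup i))
                                   (≤-reflexive (sym (∣fibre∣ (suc (suc i))))))
    }
    where
    lowest : 2 ≤ a × b ≡ 0 → 2 ≤ ∣ fibre zero ∣ × Empty (fibre (suc zero))
    lowest (2≤a , b≡0) = ≤-trans 2≤a (≤-reflexive (sym (∣fibre∣ zero))) ,
      λ (p , p∈) → <⇒≢ (x∈p⇒0<∣p∣ p∈) (sym (trans (∣fibre∣ (suc zero)) b≡0))

  open Partition partition

  tail-list : toList (tabulate tailEntry) ≡ map plain cs
  tail-list = toList-tabulate-lookup plain cs tailEntry (λ i → cong plain (∣fibre∣ (suc (suc i))))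

  type-low : r zero < a → toList (type partition) ≡ plain (a ∸ 1) ∷ plain 0 ∷ map plain cs
  type-low r0<a with type-shape
  ... | _ , _ , 0∈B₀ 0∈ _ _ , _ with () ← trans (sym (r0<a⇒f0≡0 r0<a)) (∈-fibre⁻ 0∈)
  ... | _ , _ , 0∉B₀ _ _ _ _ , eq = trans (cong toList eq)
          (cong₂ (λ x xs → plain (x ∸ 1) ∷ plain 0 ∷ xs) (∣fibre∣ zero) tail-list)

  type-high : a ≤ r zero → toList (type partition) ≡ plain a ∷ ((b ∸ 1) °) ∷ map plain cs
  type-high a≤r0 with type-shape
  ... | _ , _ , 0∉B₀ _ _ _ f0≡0 , _ = ⊥-elim (<⇒≱ (f0≡0⇒r0<a (toℕ-injective f0≡0)) a≤r0)
  ... | _ , _ , 0∈B₀ _ _ _ , eq = trans (cong toList eq)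
          (cong₂ _∷_ (cong plain (∣fibre∣ zero))
            (cong₂ _∷_ (cong (λ x → (x ∸ 1) °) (∣fibre∣ (suc zero))) tail-list))

map-∣plain∣ : ∀ t cs → map ∣_∣ₑ (take t (map plain cs)) ≡ take t cs
map-∣plain∣ zero    cs       = refl
map-∣plain∣ (suc t) []       = refl
map-∣plain∣ (suc t) (c ∷ cs) = cong (c ∷_) (map-∣plain∣ t cs)

tabulate-plain : ∀ {K} (g : Fin K → Entry) cs → toList (tabulate g) ≡ map plain cs →
                 ∀ i → ∃[ c ] g i ≡ plain c
tabulate-plain g (c ∷ cs) eq zero    = c , ∷-injectiveˡ eq
tabulate-plain g (c ∷ cs) eq (suc i) = tabulate-plain (g ∘ suc) cs (∷-injectiveʳ eq) i

module PlainType {n : ℕ} (X : SkewedBinaryPartition n) {a : ℕ} {e : Entry} {cs : List ℕ}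
                 (type≡ : toList (type X) ≡ plain a ∷ e ∷ map plain cs) (∣e∣≡0 : ∣ e ∣ₑ ≡ 0)
  where
  open SkewedBinaryPartition X
  open Partition X

  C-plain : ∀ t → C (2 + t) ≡ suc (a + sum (take t cs))
  C-plain t = begin
    C (2 + t)                                                    ≡⟨ C-S t ⟩
    suc (S (type X) t)
      ≡⟨ cong (λ l → suc (sum (map ∣_∣ₑ (take (2 + t) l)))) type≡ ⟩
    suc (a + (∣ e ∣ₑ + sum (map ∣_∣ₑ (take t (map plain cs)))))
      ≡⟨ cong₂ (λ y xs → suc (a + (y + sum xs))) ∣e∣≡0 (map-∣plain∣ t cs) ⟩
    suc (a + sum (take t cs))                                    ∎
    where open ≡-Reasoning

  data Start : Set where
    low  : e ≡ plain 0 → C 1 ≡ suc a → Start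
    high : e ≡ 0 ° → C 1 ≡ a → level zero ≡ 1 → Start

  ∣B₀∣≤1×start : ∣ B₀ ∣ ≤ 1 × Start
  ∣B₀∣≤1×start with type-shape
  ... | e₁ , e₂ , head , eq = go head (∷-injectiveˡ eq′) (∷-injectiveˡ (∷-injectiveʳ eq′))
    where
    eq′ : e₁ ∷ e₂ ∷ toList (tabulate tailEntry) ≡ plain a ∷ e ∷ map plain cs
    eq′ = trans (cong toList (sym eq)) type≡

    go : ∀ {e₁ e₂} → Head e₁ e₂ → e₁ ≡ plain a → e₂ ≡ e → ∣ B₀ ∣ ≤ 1 × Start
    go (0∈B₀ _ 1≤ level≡1) refl refl =
      m∸n≡0⇒m≤n ∣e∣≡0 , high (cong _° ∣e∣≡0) C-1 level≡1
    go (0∉B₀ _ 2≤ ≡0 _) refl refl =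
      ≤-trans (≤-reflexive ≡0) z≤n , low refl (trans C-1 (sym (m+[n∸m]≡n (<⇒≤ 2≤))))

  start : Start
  start = proj₂ ∣B₀∣≤1×start

  -- The labels of the tail blocks can be read off from the undecorated entries. The entry of `B₀`
  -- hides its label, but the block has at most one element, and once it has one, `singleton` makes
  -- it non-homogeneous.
  antichains : ∀ p → ¬ IsHomogeneous (level p)
  antichains p (zero , _ , hom) = homogeneous≢nonHomogeneous (trans (sym hom) B₋₁-nonHomogeneous)
  antichains p (suc zero , 1≡ , hom) = homogeneous≢nonHomogeneous (trans (sym hom) (singleton zero
    (≤-antisym (proj₁ ∣B₀∣≤1×start) (x∈p⇒0<∣p∣ {p = B₀} (level⇒∈ (sym 1≡))))))
  antichains p (suc (suc i) , _ , hom)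
    with e₁ , e₂ , _ , eq ← type-shape
    with c , plain≡ ← tabulate-plain tailEntry cs
           (∷-injectiveʳ (∷-injectiveʳ (trans (cong toList (sym eq)) type≡))) i
    with () ← trans (cong (λ l → decorate X l ∣ block (suc (suc i)) ∣) (sym hom)) plain≡

-- Comparison with the multiplicity vector

sum-take-drop : ∀ a t bs → sum (take (a + t) bs) ≡ sum (take a bs) + sum (take t (drop a bs))
sum-take-drop zero    t bs       = refl
sum-take-drop (suc a) t []       = cong sum (sym (take-[] t))
sum-take-drop (suc a) t (b ∷ bs) = trans (cong (b +_) (sum-take-drop a t bs)) (sym (+-assoc b _ _))

sum-take-all : ∀ {s} bs → length bs ≤ s → sum (take s bs) ≡ sum bs
sum-take-all {s} bs ℓ≤s = cong sum (take-all s bs ℓ≤s)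

module Multiplicity {n : ℕ} (m : MultiplicityVector n) where
  open MultiplicityVector m

  M-mono : ∀ {i j} → i ≤ j → M i ≤ M j
  M-mono {i} {j} i≤j with d , refl ← m≤n⇒∃[o]m+o≡n i≤j =
    +-monoʳ-≤ m₀ (≤-trans (m≤m+n _ _) (≤-reflexive (sym (sum-take-drop i d ms))))

  m₀≤M : ∀ i → m₀ ≤ M i
  m₀≤M i = m≤m+n m₀ _

  M-0 : M 0 ≡ m₀
  M-0 = +-identityʳ m₀

  M-ℓ : ∀ {i} → ℓ ≤ i → M i ≡ n
  M-ℓ ℓ≤i = trans (cong (m₀ +_) (sum-take-all ms ℓ≤i)) magnitude

  m₀<n : m₀ < n
  m₀<n = <-≤-trans (m<m+n m₀ (0<sum ms positive ℓ≥1)) (≤-reflexive magnitude)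
    where
    0<sum : ∀ xs → All (1 ≤_) xs → 1 ≤ length xs → 0 < sum xs
    0<sum (x ∷ xs) (1≤x ∷ᵃ _) _ = ≤-trans 1≤x (m≤m+n x _)

-- The index x is the sum of the first two entries of type A.
record Frame {n : ℕ} (m : MultiplicityVector n) (A : SkewedBinaryPartition n) (x : ℕ) : Set where
  open MultiplicityVector m
  open Partition A
  field
    g          : ℕ
    antichains : ∀ p → ¬ IsHomogeneous (level p)
    C₂         : C 2 ≡ suc x
    C₃         : ∀ t → C (3 + t) ≡ suc (M (suc g + t))
    M≤x        : M g ≤ x

module _ {n : ℕ} {m : MultiplicityVector n} {A : SkewedBinaryPartition n} where
  open MultiplicityVector m
  open Multiplicity m
  open Partition A

  frame-a₀-pos : toList (type A) ≡ plain m₀ ∷ plain 0 ∷ map plain ms → Frame m A m₀ × C 1 ≡ suc m₀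
  frame-a₀-pos eq = record
    { g          = 0
    ; antichains = antichains
    ; C₂         = trans (C-plain 0) (cong suc (+-identityʳ m₀))
    ; C₃         = λ t → C-plain (suc t)
    ; M≤x        = ≤-reflexive M-0
    } , C₁ start
    where
    open PlainType A {cs = ms} eq refl
    C₁ : Start → C 1 ≡ suc m₀
    C₁ (low _ C₁≡) = C₁≡

  frame-late : ∀ {x cs} → toList (type A) ≡ plain x ∷ (0 °) ∷ map plain cs →
               ∀ g → M g ≤ x → (∀ t → x + sum (take (suc t) cs) ≡ M (suc g + t)) →
               Frame m A x × C 1 ≡ x × level zero ≡ 1
  frame-late {x} {cs} eq g M≤x tail≡ = record
    { g          = g
    ; antichains = antichains
    ; C₂         = trans (C-plain 0) (cong suc (+-identityʳ x))
    ; C₃         = λ t → trans (C-plain (suc t)) (cong suc (tail≡ t))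
    ; M≤x        = M≤x
    } , C₁ start
    where
    open PlainType A {cs = cs} eq refl
    C₁ : Start → C 1 ≡ x × level zero ≡ 1
    C₁ (high _ C₁≡ l≡1) = C₁≡ , l≡1

  frame-a₀-zero : m₀ ≡ 0 → toList (type A) ≡ plain 0 ∷ (0 °) ∷ map plain ms →
                  Frame m A 0 × C 1 ≡ 0 × level zero ≡ 1
  frame-a₀-zero m₀≡0 eq = frame-late {cs = ms} eq 0 (≤-reflexive (trans M-0 m₀≡0))
    (λ t → cong (_+ sum (take (suc t) ms)) (sym m₀≡0))

  frame-aᵢ : ∀ i g → sum (take g ms) ≤ i → i < sum (take (suc g) ms) →
             toList (type A) ≡ plain (m₀ + i) ∷ (0 °) ∷ plain (sum (take (suc g) ms) ∸ i)
                                 ∷ map plain (drop (suc g) ms) →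
             Frame m A (m₀ + i) × C 1 ≡ m₀ + i × level zero ≡ 1
  frame-aᵢ i g ≤i i< eq =
    frame-late {cs = (Σg ∸ i) ∷ drop (suc g) ms} eq g (+-monoʳ-≤ m₀ ≤i) tail≡
    where
    open ≡-Reasoning
    Σg = sum (take (suc g) ms)
    tail≡ : ∀ t → m₀ + i + ((Σg ∸ i) + sum (take t (drop (suc g) ms))) ≡ M (suc g + t)
    tail≡ t = begin
      m₀ + i + ((Σg ∸ i) + σ)    ≡⟨ +-assoc m₀ i _ ⟩
      m₀ + (i + ((Σg ∸ i) + σ))  ≡⟨ cong (m₀ +_) (+-assoc i _ σ) ⟨
      m₀ + (i + (Σg ∸ i) + σ)    ≡⟨ cong (λ y → m₀ + (y + σ)) (m+[n∸m]≡n (<⇒≤ i<)) ⟩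
      m₀ + (Σg + σ)              ≡⟨ cong (m₀ +_) (sum-take-drop (suc g) t ms) ⟨
      M (suc g + t)              ∎
      where σ = sum (take t (drop (suc g) ms))

  frame-aᵣ : toList (type A) ≡ plain n ∷ (0 °) ∷ [] → Frame m A n × C 1 ≡ n × level zero ≡ 1
  frame-aᵣ eq = frame-late {cs = []} eq ℓ (≤-reflexive (M-ℓ ≤-refl))
    (λ t → trans (+-identityʳ n) (sym (M-ℓ (m≤n⇒m≤1+n (m≤m+n ℓ t)))))

  -- This keeps what `Frame` forgets, the place of 0 in A. The first constructor covers the type a₀
  -- for positive `m₀`. In the second, `m₀ ≡ 0` comes from the other form of a₀ and `m₀ < x` from
  -- all remaining types.
  data Kind (x : ℕ) : Set where
    early : x ≡ m₀ → C 1 ≡ suc x → Kind x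
    late  : C 1 ≡ x → level zero ≡ 1 → m₀ < x ⊎ m₀ ≡ 0 → Kind x

  Ω⇒frame : toList (type A) ∈Ω m → ∃[ x ] (Frame m A x × Kind x)
  Ω⇒frame type∈Ω = go type∈Ω refl
    where
    go : ∀ {l} → l ∈Ω m → toList (type A) ≡ l → ∃[ x ] (Frame m A x × Kind x)
    go (a₀-pos _)     eq = let F , C₁ = frame-a₀-pos eq in m₀ , F , early refl C₁
    go (a₀-zero m₀≡0) eq = let F , C₁ , l≡1 = frame-a₀-zero m₀≡0 eq in 0 , F , late C₁ l≡1 (inj₂ m₀≡0)
    go (aᵢ i g 1≤i _ ≤i i<) eq = let F , C₁ , l≡1 = frame-aᵢ i g ≤i i< eq in
      m₀ + i , F , late C₁ l≡1 (inj₁ (m<m+n m₀ 1≤i))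
    go aᵣ             eq = let F , C₁ , l≡1 = frame-aᵣ eq in n , F , late C₁ l≡1 (inj₁ m₀<n)

-- Containment in a level of A and the inequalities (∗)

module Fitting {n : ℕ} {m : MultiplicityVector n} {A : SkewedBinaryPartition n} {x : ℕ}
               (F : Frame m A x) (B : SkewedBinaryPartition n)
  where
  open MultiplicityVector m
  open Multiplicity m
  open Frame F
  module PA = Partition A
  module PB = Partition B

  b = type B

  In : ℕ → ℕ → Set
  In = Inside PA.level PB.level

  FitsAt : ℕ → ℕ → Set
  FitsAt i j = M i ≤ S b j × S b j < S b (suc j) × S b (suc j) ≤ M (suc i)

  -- With 0 left out, level `2 + t` of A extends from `M (g + t)` to `M (suc g + t)`, except that
  -- level 2 starts at `x` instead of `M g`. For `i ≤ g` the truncated difference is 0, and the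
  -- lower bound is supplied by `x ≤ S b j`.
  fits⇒in : ∀ {i j} → x ≤ S b j → FitsAt i j → In (2 + (i ∸ g)) (2 + j)
  fits⇒in {i} {j} x≤S (M≤S , _ , S≤M) with suc g ≤? i
  ... | no g≮i rewrite m≤n⇒m∸n≡0 (≮⇒≥ g≮i) =
          ≤-trans (≤-reflexive C₂) (≤-trans (s≤s x≤S) (≤-reflexive (sym (PB.C-S j)))) ,
          (begin
            PB.C (3 + j)             ≡⟨ PB.C-S (suc j) ⟩
            suc (S b (suc j))        ≤⟨ s≤s S≤M ⟩
            suc (M (suc i))          ≤⟨ s≤s (M-mono (s≤s (≤-trans (≮⇒≥ g≮i) (m≤m+n g 0)))) ⟩
            suc (M (suc g + 0))      ≡⟨ C₃ 0 ⟨
            PA.C 3                   ∎)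
          where open ≤-Reasoning
  ... | yes g<i with d , refl ← m≤n⇒∃[o]m+o≡n g<i
      rewrite trans (cong (_∸ g) (sym (+-suc g d))) (m+n∸m≡n g (suc d)) =
          (begin
            PA.C (3 + d)             ≡⟨ C₃ d ⟩
            suc (M (suc g + d))      ≤⟨ s≤s M≤S ⟩
            suc (S b j)              ≡⟨ PB.C-S j ⟨
            PB.C (2 + j)             ∎) ,
          (begin
            PB.C (3 + j)             ≡⟨ PB.C-S (suc j) ⟩
            suc (S b (suc j))        ≤⟨ s≤s S≤M ⟩
            suc (M (2 + (g + d)))    ≡⟨ cong (λ i → suc (M (suc i))) (+-suc g d) ⟨
            suc (M (suc g + suc d))  ≡⟨ C₃ (suc d) ⟨
            PA.C (4 + d)             ∎)
          where open ≤-Reasoning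

  in⇒2≤ : ∀ {s j} → x < S b (suc j) → In s (2 + j) → 2 ≤ s
  in⇒2≤ {s} {j} x<S (_ , upper) = ≮⇒≥ (λ s<2 → <⇒≱ (s<s x<S) (begin
      suc (S b (suc j))  ≡⟨ PB.C-S (suc j) ⟨
      PB.C (3 + j)       ≤⟨ upper ⟩
      PA.C (suc s)       ≤⟨ PA.C-mono s<2 ⟩
      PA.C 2             ≡⟨ C₂ ⟩
      suc x              ∎))
    where open ≤-Reasoning

  in⇒fits : ∀ {s j} → S b j < S b (suc j) → In (2 + s) (2 + j) → FitsAt (g + s) j
  in⇒fits {s} {j} S<S (lower , upper) = lower′ s lower , S<S , s≤s⁻¹ (begin
      suc (S b (suc j))  ≡⟨ PB.C-S (suc j) ⟨
      PB.C (3 + j)       ≤⟨ upper ⟩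
      PA.C (3 + s)       ≡⟨ C₃ s ⟩
      suc (M (suc g + s)) ∎)
    where
    open ≤-Reasoning
    lower′ : ∀ s → PA.C (2 + s) ≤ PB.C (2 + j) → M (g + s) ≤ S b j
    lower′ zero low = begin
      M (g + 0)  ≡⟨ cong M (+-identityʳ g) ⟩
      M g        ≤⟨ M≤x ⟩
      x          ≤⟨ s≤s⁻¹ (≤-trans (≤-reflexive (sym C₂)) (≤-trans low (≤-reflexive (PB.C-S j)))) ⟩
      S b j      ∎
    lower′ (suc t) low = begin
      M (g + suc t)  ≡⟨ cong M (+-suc g t) ⟩
      M (suc g + t)  ≤⟨ s≤s⁻¹ (≤-trans (≤-reflexive (sym (C₃ t))) (≤-trans low (≤-reflexive (PB.C-S j)))) ⟩
      S b j          ∎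

  fits<ℓ : ∀ {i j} → FitsAt i j → i < ℓ
  fits<ℓ {i} {j} (M≤S , S<S , S≤M) = ≰⇒> (λ ℓ≤i → <⇒≱ S<S (begin
      S b (suc j)  ≤⟨ S≤M ⟩
      M (suc i)    ≡⟨ M-ℓ (m≤n⇒m≤1+n ℓ≤i) ⟩
      n            ≡⟨ M-ℓ ℓ≤i ⟨
      M i          ≤⟨ M≤S ⟩
      S b j        ∎))
    where open ≤-Reasoning

  -- The equation records that `i` depends on `s` alone: two blocks in the same level of A fit the
  -- same `i`, as needed to apply the uniqueness in condition (2). The bound `i < ℓ` holds because
  -- `M` is constant from `ℓ` on and leaves no room for a nonempty block.
  in⇒Fits : ∀ {s} (j : Fin (SkewedBinaryPartition.k B)) → x < S b (suc (toℕ j)) → In s (2 + toℕ j) →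
            ∃[ i ] (Fits m b i j × toℕ i ≡ g + (s ∸ 2))
  in⇒Fits {s} j x<S ins with t , refl ← m≤n⇒∃[o]m+o≡n (in⇒2≤ {s} x<S ins) =
      fromℕ< i<ℓ , subst (λ i → FitsAt i (toℕ j)) (sym (toℕ-fromℕ< i<ℓ)) fits , toℕ-fromℕ< i<ℓ
    where
    fits = in⇒fits {t} {toℕ j} (PB.S-< j) ins
    i<ℓ  = fits<ℓ {g + t} {toℕ j} fits

  -- For an early A the number `x` may exceed `S b 0`, but then it equals `m₀`, which is less than
  -- `S b 1` and at most every `M i`. For a late A it is at most `S b 0`. Either way the tail blocks
  -- of B can be compared with the levels of A from 2 on.
  module Bounds (m₀<S₁ : m₀ < S b 1) (x-small : x ≡ m₀ ⊎ x ≤ S b 0) where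

    x<S : (j : Fin (SkewedBinaryPartition.k B)) → x < S b (suc (toℕ j))
    x<S j = [ (λ x≡m₀ → <-≤-trans (≤-<-trans (≤-reflexive x≡m₀) m₀<S₁) (PB.S-mono (s≤s z≤n)))
            , (λ x≤S₀ → ≤-<-trans (≤-trans x≤S₀ (PB.S-mono z≤n)) (PB.S-< j)) ]′ x-small

    Fits⇒x≤S : ∀ i j → Fits m b i j → x ≤ S b (toℕ j)
    Fits⇒x≤S i j (M≤S , _) =
      [ (λ x≡m₀ → ≤-trans (≤-reflexive x≡m₀) (≤-trans (m₀≤M (toℕ i)) M≤S))
      , (λ x≤S₀ → ≤-trans x≤S₀ (PB.S-mono z≤n)) ]′ x-small

-- The three conditions and their necessity

Condition₁ Condition₂ Condition₃ : ∀ {n} → MultiplicityVector n → SkewedBinaryPartition n → Set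
Condition₁ m B =
  (0 < S (type B) 0 × S (type B) 0 ≤ MultiplicityVector.m₀ m) ⇔ (lookup (type B) (suc zero) ≡ plain 0)
Condition₂ m B = MultiplicityVector.m₀ m < S (type B) 1 ×
  (∀ (i : Fin (MultiplicityVector.ℓ m)) (j j′ : Fin (SkewedBinaryPartition.k B)) →
   Fits m (type B) i j → Fits m (type B) i j′ → j ≡ j′)
Condition₃ m B = ∀ (j : Fin (SkewedBinaryPartition.k B)) →
  ((∃[ i ] Fits m (type B) i j) → ∃[ c ] (1 ≤ c × lookup (type B) (suc (suc j)) ≡ plain c)) ×
  (¬ (∃[ i ] Fits m (type B) i j) → ∃[ c ] (2 ≤ c × lookup (type B) (suc (suc j)) ≡ c ⋆))

empty⊎first : ∀ k → k ≡ 0 ⊎ ∃[ j ] (toℕ {k} j ≡ 0)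
empty⊎first zero    = inj₁ refl
empty⊎first (suc k) = inj₂ (zero , refl)

module Necessity {n : ℕ} {m : MultiplicityVector n} {A B : SkewedBinaryPartition n} {x : ℕ}
                 (F : Frame m A x) (kind : Kind {m = m} {A} x) (B≺A : B IsContractionOf A)
  where
  open MultiplicityVector m
  open Multiplicity m
  open Frame F
  open Fitting F B
  open SkewedBinaryPartition B

  module L = Levels {E = PA.IsHomogeneous} PB.isHomogeneous? antichains PB.class-not-singleton
                    PA.≼⇔LevelOrder PB.≼⇔LevelOrder

  open Refines (proj₂ (L.contraction⇒ B≺A))

  block-inside : ∀ i → Nonempty (block i) → label i ≡ nonHomogeneous → ∃[ s ] In s (toℕ i)
  block-inside i (p , p∈) non with s , ins ← antichain-inside p
      (λ hom → homogeneous≢nonHomogeneous (trans (sym (PB.IsHomogeneous⇒label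
                 (subst PB.IsHomogeneous (PB.∈⇒level p∈) hom))) non))
    = s , subst (In s) (PB.∈⇒level p∈) ins

  inside⇒¬hom : ∀ {i s p} → p ∈ block i → In s (toℕ i) → ¬ PB.IsHomogeneous (PB.level p)
  inside⇒¬hom {s = s} {p} p∈ ins hom = class-crosses p hom s (subst (In s) (sym (PB.∈⇒level p∈)) ins)

  inside⇒nonHom : ∀ {i s} → Nonempty (block i) → In s (toℕ i) → label i ≡ nonHomogeneous
  inside⇒nonHom {i} (p , p∈) ins = ¬homogeneous⇒nonHomogeneous
    (λ hom → inside⇒¬hom p∈ ins (i , sym (PB.∈⇒level p∈) , hom))

  inside-unique : ∀ {i j s} → Nonempty (block i) → Nonempty (block j) →
                  In s (toℕ i) → In s (toℕ j) → i ≡ j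
  inside-unique {s = s} (p , p∈) (q , q∈) insᵢ insⱼ = toℕ-injective (trans (sym (PB.∈⇒level p∈))
    (trans (antichains-separate p q s (inside⇒¬hom p∈ insᵢ) (inside⇒¬hom q∈ insⱼ)
      (subst (In s) (sym (PB.∈⇒level p∈)) insᵢ) (subst (In s) (sym (PB.∈⇒level q∈)) insⱼ)) (PB.∈⇒level q∈)))

  in-zero : ∀ {j} → PB.C (suc j) ≤ PA.C 1 → In 0 j
  in-zero ≤C₁ = ≤-trans (≤-reflexive PA.C-0) z≤n , ≤C₁

  -- The `x` elements of the first block of A precede 0 in A, hence also in B, so they lie in the
  -- first two blocks of B. Counting 0 as well makes the inequality strict before the extra one is
  -- removed.
  late⇒x≤S₀ : PA.C 1 ≡ x → PA.level zero ≡ 1 → x ≤ S b 0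
  late⇒x≤S₀ C₁ level≡1 = s≤s⁻¹ (begin-strict
      x            ≡⟨ C₁ ⟨
      PA.C 1
        <⟨ #-mono-< {f = PA.level} {PB.level} {1} {2} below {zero} (≤-reflexive (sym level≡1)) (s≤s PB.level-0≤1) ⟩
      PB.C 2       ≡⟨ PB.C-S 0 ⟩
      suc (S b 0)  ∎)
    where
    open ≤-Reasoning
    below : ∀ {p} → PA.level p < 1 → PB.level p < 2
    below p<1 = s≤s (≤-trans (L.S⇒≤ (proj₁ (L.contraction⇒ B≺A)
      (L.<⇒R (<-≤-trans p<1 (≤-reflexive (sym level≡1)))))) PB.level-0≤1)

  x-small : Kind {m = m} {A} x → x ≡ m₀ ⊎ x ≤ S b 0
  x-small (early x≡m₀ _)  = inj₁ x≡m₀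
  x-small (late C₁ l≡1 _) = inj₂ (late⇒x≤S₀ C₁ l≡1)

  0∈block : ∃[ i ] (toℕ i ≤ 1 × zero ∈ block i)
  0∈block with 0∈B₋₁∪B₀
  ... | inj₁ 0∈ = zero , z≤n , 0∈
  ... | inj₂ 0∈ = suc zero , ≤-refl , 0∈

  -- If an early A violated this, the first level of A, of size `suc m₀`, would contain both the
  -- block of 0 and the block with index 1, two different blocks in one level. When `k` is 0, the
  -- truncated sum `S b 1` is `n`.
  m₀<S₁ : Kind {m = m} {A} x → m₀ < S b 1
  m₀<S₁ kind with empty⊎first k
  ... | inj₁ k≡0 = <-≤-trans m₀<n (≤-reflexive (suc-injective
          (trans (sym (PB.C-const 3 (≤-trans (≤-reflexive (cong (2 +_) k≡0)) (n≤1+n 2)))) (PB.C-S 1))))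
  ... | inj₂ (j , j≡0) with kind
  ...   | late C₁ l≡1 _ = begin-strict
            m₀              ≤⟨ m₀≤M g ⟩
            M g             ≤⟨ M≤x ⟩
            x               ≤⟨ late⇒x≤S₀ C₁ l≡1 ⟩
            S b 0           ≡⟨ cong (S b) j≡0 ⟨
            S b (toℕ j)     <⟨ PB.S-< j ⟩
            S b (suc (toℕ j)) ≡⟨ cong (S b ∘ suc) j≡0 ⟩
            S b 1           ∎
          where open ≤-Reasoning
  ...   | early x≡m₀ C₁ = ≰⇒> λ S₁≤m₀ → clash S₁≤m₀ 0∈block
    where
    clash : S b 1 ≤ m₀ → ¬ (∃[ i ] (toℕ i ≤ 1 × zero ∈ block i))
    clash S₁≤m₀ (i , i≤1 , 0∈) = <⇒≢ (s≤s i≤1) (trans (cong toℕ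
        (inside-unique {i} {suc (suc j)} (zero , 0∈) (nonempty j)
          (in-zero (≤-trans (PB.C-mono (s≤s (≤-trans i≤1 (n≤1+n 1)))) C₃≤))
          (in-zero (≤-trans (≤-reflexive (cong (λ j → PB.C (3 + j)) j≡0)) C₃≤))))
        (cong (2 +_) j≡0))
      where
      C₃≤ : PB.C 3 ≤ PA.C 1
      C₃≤ = ≤-trans (≤-reflexive (PB.C-S 1)) (≤-trans (s≤s S₁≤m₀) (≤-reflexive (sym (trans C₁ (cong suc x≡m₀)))))

  open Bounds (m₀<S₁ kind) (x-small kind)

  low⇒plain0 : Kind {m = m} {A} x → 0 < S b 0 × S b 0 ≤ m₀ → lookup b (suc zero) ≡ plain 0
  low⇒plain0 kind (0<S₀ , S₀≤m₀) with PB.lookup-B₀ | kind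
  ... | inj₁ (eq , _) | _ = eq
  ... | inj₂ _ | late C₁ l≡1 (inj₁ m₀<x) = ⊥-elim (<⇒≱ m₀<x (≤-trans (late⇒x≤S₀ C₁ l≡1) S₀≤m₀))
  ... | inj₂ _ | late _ _ (inj₂ m₀≡0) = ⊥-elim (<⇒≱ 0<S₀ (≤-trans S₀≤m₀ (≤-reflexive m₀≡0)))
  -- Here both head blocks of B lie in the first level of A. So `B₀` is not homogeneous, hence
  -- consists of 0 alone, and `B₋₁` cannot be a second nonempty block there; but then `S b 0` would
  -- be 0.
  ... | inj₂ (_ , 0∈ , _) | early x≡m₀ C₁ = ⊥-elim (<⇒≱ (s<s 0<S₀) (begin
          suc (S b 0)        ≡⟨ PB.C-S 0 ⟨
          PB.C 2             ≡⟨ PB.C-2 ⟩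
          ∣ B₋₁ ∣ + ∣ B₀ ∣   ≡⟨ cong (_+ ∣ B₀ ∣) (Empty⇒∣p∣≡0 B₋₁-empty) ⟩
          ∣ B₀ ∣             ≤⟨ ∣B₀∣≤1 ⟩
          1                  ∎))
    where
    open ≤-Reasoning
    C₂≤ : PB.C 2 ≤ PA.C 1
    C₂≤ = ≤-trans (≤-reflexive (PB.C-S 0))
                  (≤-trans (s≤s S₀≤m₀) (≤-reflexive (sym (trans C₁ (cong suc x≡m₀)))))

    ∣B₀∣≤1 : ∣ B₀ ∣ ≤ 1
    ∣B₀∣≤1 = ≮⇒≥ (λ 1<∣B₀∣ → homogeneous≢nonHomogeneous (trans (sym (B₀-homogeneous 1<∣B₀∣))
               (inside⇒nonHom {suc zero} (zero , 0∈) (in-zero C₂≤))))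

    B₋₁-empty : Empty B₋₁
    B₋₁-empty ne with () ← inside-unique {zero} {suc zero} ne (zero , 0∈)
      (in-zero (≤-trans (PB.C-mono (n≤1+n 1)) C₂≤)) (in-zero C₂≤)

  plain0⇒low : lookup b (suc zero) ≡ plain 0 → 0 < S b 0 × S b 0 ≤ m₀
  plain0⇒low eq with PB.lookup-B₀
  ... | inj₂ (≢plain0 , _) = ⊥-elim (≢plain0 eq)
  ... | inj₁ (_ , _ , 2≤ , ∣B₀∣≡0) = s<s⁻¹ (≤-trans 2≤C₁ (≤-reflexive C₁≡1+S₀)) , S₀≤m₀
    where
    C₁≡1+S₀ : PB.C 1 ≡ suc (S b 0)
    C₁≡1+S₀ = trans (sym (+-identityʳ _)) (trans (cong₂ _+_ PB.C-1 (sym ∣B₀∣≡0))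
                (trans (sym PB.C-2) (PB.C-S 0)))

    2≤C₁ : 2 ≤ PB.C 1
    2≤C₁ = ≤-trans 2≤ (≤-reflexive (sym PB.C-1))

    -- The block `B₋₁` has at least two elements and starts at the very bottom, so all levels of A
    -- below `s` are empty. In a late A, level 0 is too small, level 1 contains only 0, and any
    -- higher level has 0 below it. What remains is level 0 of an early A, of size `suc m₀`.
    bound : Kind {m = m} {A} x → ∀ s → In s 0 → S b 0 ≤ m₀
    bound (early x≡m₀ C₁) zero (low , up) =
      s≤s⁻¹ (≤-trans (≤-reflexive (sym C₁≡1+S₀)) (≤-trans up (≤-reflexive (trans C₁ (cong suc x≡m₀)))))
    bound (early _ C₁) (suc s) (low , up) = ⊥-elim (n≮0 (≤-trans
      (≤-trans (≤-reflexive (sym C₁)) (PA.C-mono (s≤s z≤n))) (≤-trans low (≤-reflexive PB.C-0))))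
    bound (late C₁ l≡1 _) zero (low , up) = ⊥-elim (<⇒≱ (s≤s (late⇒x≤S₀ C₁ l≡1))
      (≤-trans (≤-reflexive (sym C₁≡1+S₀)) (≤-trans up (≤-reflexive C₁))))
    bound (late C₁ l≡1 _) (suc zero) (low , up) = ⊥-elim (<⇒≱ 2≤C₁ (≤-trans up
      (≤-trans (≤-reflexive C₂) (s≤s (≤-trans (≤-reflexive (sym C₁)) (≤-trans low (≤-reflexive PB.C-0)))))))
    bound (late C₁ l≡1 _) (suc (suc s)) (low , up) = ⊥-elim (n≮0 (≤-trans
      (≤-trans (≤-reflexive (sym C₂)) (PA.C-mono (s≤s (s≤s z≤n)))) (≤-trans low (≤-reflexive PB.C-0))))

    S₀≤m₀ : S b 0 ≤ m₀
    S₀≤m₀ with s , ins ← block-inside zero (0<∣p∣⇒Nonempty (<⇒≤ 2≤)) B₋₁-nonHomogeneous = bound kind s ins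

  Fits⇒in : ∀ i j → Fits m b i j → In (2 + (toℕ i ∸ g)) (2 + toℕ j)
  Fits⇒in i j fits = fits⇒in {toℕ i} {toℕ j} (Fits⇒x≤S i j fits) fits

  condition₂ : Condition₂ m B
  condition₂ = m₀<S₁ kind , λ i j j′ fits fits′ → sucᶠ-injective (sucᶠ-injective
    (inside-unique {suc (suc j)} {suc (suc j′)} (nonempty j) (nonempty j′)
      (Fits⇒in i j fits) (Fits⇒in i j′ fits′)))

  tail-size : Fin k → ℕ
  tail-size j = ∣ block (suc (suc j)) ∣

  0<tail-size : ∀ j → 0 < tail-size j
  0<tail-size j with p , p∈ ← nonempty j = x∈p⇒0<∣p∣ p∈

  condition₃ : Condition₃ m B
  condition₃ j =
    (λ (i , fits) → tail-size j , 0<tail-size j , trans (PB.lookup-tail j)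
      (cong (λ l → decorate B l (tail-size j)) (inside⇒nonHom {suc (suc j)} (nonempty j) (Fits⇒in i j fits)))) ,
    λ ¬fits → tail-size j , ≤∧≢⇒< (0<tail-size j) (λ 1≡ → homogeneous≢nonHomogeneous
        (trans (sym (hom ¬fits)) (singleton (suc j) (sym 1≡)))) ,
      trans (PB.lookup-tail j) (cong (λ l → decorate B l (tail-size j)) (hom ¬fits))
    where
    hom : ¬ (∃[ i ] Fits m b i j) → label (suc (suc j)) ≡ homogeneous
    hom ¬fits with PB.homogeneous? (label (suc (suc j)))
    ... | yes eq = eq
    ... | no ≢hom with s , ins ← block-inside (suc (suc j)) (nonempty j) (¬homogeneous⇒nonHomogeneous ≢hom)
                  with i , fits , _ ← in⇒Fits {s} j (x<S j) ins = ⊥-elim (¬fits (i , fits))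

-- Sufficiency of the conditions for an A whose levels are monotone along B

module Sufficiency {n : ℕ} {m : MultiplicityVector n} {A B : SkewedBinaryPartition n} {x : ℕ}
                   (F : Frame m A x)
                   (mono : Monotone (Partition.level A) (Partition.level B))
                   (condition₁ : Condition₁ m B) (condition₂ : Condition₂ m B) (condition₃ : Condition₃ m B)
  where
  open MultiplicityVector m
  open Multiplicity m
  open Frame F
  open Fitting F B
  open SkewedBinaryPartition B

  -- An early A takes both head blocks of B into its first level. A late A is cut at `S b 0`, one
  -- element before the end of the head of B: a singleton `B₀` then coincides with level 1 of A,
  -- whereas a homogeneous `B₀` straddles the cut.
  data Alignment : Set where
    early : x ≡ m₀ → PA.C 1 ≡ suc x → S b 0 ≤ m₀ → Alignment
    late  : PA.C 1 ≡ x → x ≡ S b 0 → zero ∈ B₀ → Alignment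

  x-small : Alignment → x ≡ m₀ ⊎ x ≤ S b 0
  x-small (early x≡m₀ _ _) = inj₁ x≡m₀
  x-small (late _ x≡S₀ _)  = inj₂ (≤-reflexive x≡S₀)

  S₀≤x : Alignment → S b 0 ≤ x
  S₀≤x (early x≡m₀ _ S₀≤m₀) = ≤-trans S₀≤m₀ (≤-reflexive (sym x≡m₀))
  S₀≤x (late _ x≡S₀ _)      = ≤-reflexive (sym x≡S₀)

  module _ (alignment : Alignment) where

    open Bounds (proj₁ condition₂) (x-small alignment)

    Fits? : ∀ j → Dec (∃[ i ] Fits m b i j)
    Fits? j = any? (λ i → M (toℕ i) ≤? S b (toℕ j) ×-dec
      (S b (toℕ j) <? S b (suc (toℕ j)) ×-dec S b (suc (toℕ j)) ≤? M (suc (toℕ i))))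

    nonHom⇒Fits : ∀ j → label (suc (suc j)) ≡ nonHomogeneous → ∃[ i ] Fits m b i j
    nonHom⇒Fits j non with Fits? j
    ... | yes fits = fits
    ... | no ¬fits with c , _ , eq ← proj₂ (condition₃ j) ¬fits
                   with () ← trans (sym (trans (PB.lookup-tail j)
                          (cong (λ l → decorate B l ∣ block (suc (suc j)) ∣) non))) eq

    hom⇒¬Fits : ∀ j → label (suc (suc j)) ≡ homogeneous → ¬ (∃[ i ] Fits m b i j)
    hom⇒¬Fits j hom fits with c , _ , eq ← proj₁ (condition₃ j) fits
                         with () ← trans (sym (trans (PB.lookup-tail j)
                                (cong (λ l → decorate B l ∣ block (suc (suc j)) ∣) hom))) eq

    B₀-nonempty⇒0∈ : Nonempty B₀ → zero ∈ B₀
    B₀-nonempty⇒0∈ ne with 0∈B₋₁∪B₀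
    ... | inj₁ 0∈ = ⊥-elim (proj₂ (0∈B₋₁⇒ 0∈) ne)
    ... | inj₂ 0∈ = 0∈

    -- By condition (1), a positive value would force the undecorated 0. The conclusion leaves 0 as
    -- the only element of the head, so in the early case a nonempty `B₀` is neither homogeneous nor
    -- accompanied by a nonempty `B₋₁`.
    0∈B₀∧S₀≤m₀⇒S₀≡0 : zero ∈ B₀ → S b 0 ≤ m₀ → S b 0 ≡ 0
    0∈B₀∧S₀≤m₀⇒S₀≡0 0∈ S₀≤m₀ with PB.lookup-B₀
    ... | inj₁ (_ , 0∉ , _) = ⊥-elim (0∉ 0∈)
    ... | inj₂ (≢plain0 , _) = n≤0⇒n≡0 (≮⇒≥ (λ 0<S₀ → ≢plain0 (Equivalence.to condition₁ (0<S₀ , S₀≤m₀))))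

    C₁<C₂ : Nonempty B₀ → PB.C 1 < suc (S b 0)
    C₁<C₂ ne = <-≤-trans (PB.C-< (suc zero) ne) (≤-reflexive (PB.C-S 0))

    nonHom⇒C₁≡S₀ : Nonempty B₀ → label (suc zero) ≡ nonHomogeneous → PB.C 1 ≡ S b 0
    nonHom⇒C₁≡S₀ (p , p∈) non = suc-injective (begin
        suc (PB.C 1)        ≡⟨ +-comm 1 _ ⟩
        PB.C 1 + 1          ≡⟨ cong (PB.C 1 +_) (≤-antisym (x∈p⇒0<∣p∣ p∈) (≮⇒≥ (λ 1<∣B₀∣ →
                                 homogeneous≢nonHomogeneous (trans (sym (B₀-homogeneous 1<∣B₀∣)) non)))) ⟩
        PB.C 1 + ∣ B₀ ∣     ≡⟨ PB.C-suc (suc zero) ⟨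
        PB.C 2              ≡⟨ PB.C-S 0 ⟩
        suc (S b 0)         ∎)
      where open ≡-Reasoning

    1+S₀≤C₁ : x ≡ m₀ → PA.C 1 ≡ suc x → S b 0 ≤ m₀ → suc (S b 0) ≤ PA.C 1
    1+S₀≤C₁ x≡m₀ C₁ S₀≤m₀ = ≤-trans (s≤s S₀≤m₀) (≤-reflexive (sym (trans C₁ (cong suc x≡m₀))))

    inside-B₋₁ : Alignment → PB.C 1 ≤ PA.C 1
    inside-B₋₁ (early x≡m₀ C₁ S₀≤m₀) =
      ≤-trans (PB.C-mono (n≤1+n 1)) (≤-trans (≤-reflexive (PB.C-S 0)) (1+S₀≤C₁ x≡m₀ C₁ S₀≤m₀))
    inside-B₋₁ (late C₁ x≡S₀ 0∈) =
      ≤-trans (s≤s⁻¹ (C₁<C₂ (zero , 0∈))) (≤-reflexive (sym (trans C₁ x≡S₀)))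

    inside-B₀ : Alignment → Nonempty B₀ → label (suc zero) ≡ nonHomogeneous → ∃[ s ] In s 1
    inside-B₀ (early x≡m₀ C₁ S₀≤m₀) ne non =
      0 , ≤-trans (≤-reflexive PA.C-0) z≤n , ≤-trans (≤-reflexive (PB.C-S 0)) (1+S₀≤C₁ x≡m₀ C₁ S₀≤m₀)
    inside-B₀ (late C₁ x≡S₀ 0∈) ne non =
      1 , ≤-reflexive (trans C₁ (trans x≡S₀ (sym (nonHom⇒C₁≡S₀ ne non)))) ,
      ≤-reflexive (trans (PB.C-S 0) (sym (trans C₂ (cong suc x≡S₀))))

    inside : ∀ i → Nonempty (block i) → label i ≡ nonHomogeneous → ∃[ s ] In s (toℕ i)
    inside zero          ne non = 0 , ≤-trans (≤-reflexive PA.C-0) z≤n , inside-B₋₁ alignment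
    inside (suc zero)    ne non = inside-B₀ alignment ne non
    inside (suc (suc j)) ne non with i , fits ← nonHom⇒Fits j non =
      2 + (toℕ i ∸ g) , fits⇒in {toℕ i} {toℕ j} (Fits⇒x≤S i j fits) fits

    late⇒x≰C : PA.C 1 ≡ x → x ≡ S b 0 → ∀ {s i} → PB.C i < S b 0 → ¬ PA.C (suc s) ≤ PB.C i
    late⇒x≰C C₁ x≡S₀ {s} {i} C<S₀ low = <⇒≱ C<S₀ (begin
        S b 0         ≡⟨ trans C₁ x≡S₀ ⟨
        PA.C 1        ≤⟨ PA.C-mono (s≤s z≤n) ⟩
        PA.C (suc s)  ≤⟨ low ⟩
        PB.C i        ∎)
      where open ≤-Reasoning

    late⇒C₂≰x : PA.C 1 ≡ x → x ≡ S b 0 → ¬ PB.C 2 ≤ PA.C 1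
    late⇒C₂≰x C₁ x≡S₀ up = <⇒≱ ≤-refl
      (≤-trans (≤-reflexive (sym (PB.C-S 0))) (≤-trans up (≤-reflexive (trans C₁ x≡S₀))))

    crosses-B₀ : Alignment → Nonempty B₀ → label (suc zero) ≡ homogeneous → ∀ s → ¬ In s 1
    crosses-B₀ alignment ne@(p , p∈) hom = go alignment
      where
      C₁<S₀ : PB.C 1 < S b 0
      C₁<S₀ = s<s⁻¹ (begin-strict
        suc (PB.C 1)     ≡⟨ +-comm 1 _ ⟩
        PB.C 1 + 1       <⟨ +-monoʳ-< (PB.C 1) (≤∧≢⇒< (x∈p⇒0<∣p∣ p∈) (λ 1≡ →
                              homogeneous≢nonHomogeneous (trans (sym hom) (singleton zero (sym 1≡))))) ⟩
        PB.C 1 + ∣ B₀ ∣  ≡⟨ PB.C-suc (suc zero) ⟨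
        PB.C 2           ≡⟨ PB.C-S 0 ⟩
        suc (S b 0)      ∎)
        where open ≤-Reasoning
      go : Alignment → ∀ s → ¬ In s 1
      go (early _ _ S₀≤m₀)  s       _         =
        n≮0 (≤-trans C₁<S₀ (≤-reflexive (0∈B₀∧S₀≤m₀⇒S₀≡0 (B₀-nonempty⇒0∈ ne) S₀≤m₀)))
      go (late C₁ x≡S₀ _) zero    (_ , up)  = late⇒C₂≰x C₁ x≡S₀ up
      go (late C₁ x≡S₀ _) (suc s) (low , _) = late⇒x≰C C₁ x≡S₀ {s} {1} C₁<S₀ low

    crosses : ∀ i → Nonempty (block i) → label i ≡ homogeneous → ∀ s → ¬ In s (toℕ i)
    crosses zero          ne hom s ins = homogeneous≢nonHomogeneous (trans (sym hom) B₋₁-nonHomogeneous)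
    crosses (suc zero)    ne hom s ins = crosses-B₀ alignment ne hom s ins
    crosses (suc (suc j)) ne hom s ins with i , fits , _ ← in⇒Fits {s} j (x<S j) ins =
      hom⇒¬Fits j hom (i , fits)

    -- The first two blocks of B lie below the cut C 2 of A, the others above.
    head-tail-apart : ∀ i j {s} → toℕ i ≤ 1 → Nonempty (block i) → In s (toℕ i) → ¬ In s (2 + toℕ j)
    head-tail-apart i j {s} i≤1 ne (low , _) ins = <⇒≱ (s≤s (S₀≤x alignment)) (s<s⁻¹ (begin-strict
        suc x               ≡⟨ C₂ ⟨
        PA.C 2              ≤⟨ PA.C-mono (in⇒2≤ {s} {toℕ j} (x<S j) ins) ⟩
        PA.C s              ≤⟨ low ⟩
        PB.C (toℕ i)        <⟨ PB.C-< i ne ⟩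
        PB.C (suc (toℕ i))  ≤⟨ PB.C-mono (s≤s i≤1) ⟩
        PB.C 2              ≡⟨ PB.C-S 0 ⟩
        suc (S b 0)         ∎))
      where open ≤-Reasoning

    head-apart : Nonempty B₋₁ → Nonempty B₀ → label (suc zero) ≡ nonHomogeneous →
                 ∀ s → In s 0 → ¬ In s 1
    head-apart (p , p∈) ne₀ non = go alignment
      where
      0<S₀ : 0 < S b 0
      0<S₀ = ≤-trans (x∈p⇒0<∣p∣ p∈) (≤-reflexive (trans (sym PB.C-1) (nonHom⇒C₁≡S₀ ne₀ non)))
      go : Alignment → ∀ s → In s 0 → ¬ In s 1
      go (early _ _ S₀≤m₀) s       _         _        =
        <⇒≢ 0<S₀ (sym (0∈B₀∧S₀≤m₀⇒S₀≡0 (B₀-nonempty⇒0∈ ne₀) S₀≤m₀))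
      go (late C₁ x≡S₀ _)  zero    _         (_ , up) = late⇒C₂≰x C₁ x≡S₀ up
      go (late C₁ x≡S₀ _)  (suc s) (low , _) _        =
        late⇒x≰C C₁ x≡S₀ {s} {0} (≤-<-trans (≤-reflexive PB.C-0) 0<S₀) low

    separate : ∀ i j s → Nonempty (block i) → Nonempty (block j) →
               label i ≡ nonHomogeneous → label j ≡ nonHomogeneous →
               In s (toℕ i) → In s (toℕ j) → i ≡ j
    separate zero          zero           s _ _ _ _ _ _ = refl
    separate (suc zero)    (suc zero)     s _ _ _ _ _ _ = refl
    separate zero          (suc zero)     s ne ne′ _ non ins ins′ = ⊥-elim (head-apart ne ne′ non s ins ins′)
    separate (suc zero)    zero           s ne ne′ non _ ins ins′ = ⊥-elim (head-apart ne′ ne non s ins′ ins)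
    separate zero          (suc (suc j))  s ne _ _ _ ins ins′ = ⊥-elim (head-tail-apart zero j z≤n ne ins ins′)
    separate (suc zero)    (suc (suc j))  s ne _ _ _ ins ins′ = ⊥-elim (head-tail-apart (suc zero) j ≤-refl ne ins ins′)
    separate (suc (suc j)) zero           s _ ne _ _ ins ins′ = ⊥-elim (head-tail-apart zero j z≤n ne ins′ ins)
    separate (suc (suc j)) (suc zero)     s _ ne _ _ ins ins′ = ⊥-elim (head-tail-apart (suc zero) j ≤-refl ne ins′ ins)
    separate (suc (suc j)) (suc (suc j′)) s _ _ _ _ ins ins′
      with i , fits , i≡ ← in⇒Fits {s} j (x<S j) ins | i′ , fits′ , i′≡ ← in⇒Fits {s} j′ (x<S j′) ins′
      = cong (λ j → suc (suc j)) (proj₂ condition₂ i j j′ fits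
          (subst (λ i → Fits m b i j′) (toℕ-injective (trans i′≡ (sym i≡))) fits′))

    block-of : Fin (suc n) → Fin (2 + k)
    block-of p = proj₁ (covering p)

    block-nonempty : ∀ p → Nonempty (block (block-of p))
    block-nonempty p = p , proj₂ (covering p)

    nonHom : ∀ p → ¬ PB.IsHomogeneous (PB.level p) → label (block-of p) ≡ nonHomogeneous
    nonHom p ¬hom = ¬homogeneous⇒nonHomogeneous (λ hom → ¬hom (block-of p , refl , hom))

    refines : Refines PA.level PB.level PB.IsHomogeneous
    refines = record
      { antichain-inside    = λ p ¬hom → inside (block-of p) (block-nonempty p) (nonHom p ¬hom)
      ; class-crosses       = λ p hom → crosses (block-of p) (block-nonempty p) (PB.IsHomogeneous⇒label hom)
      ; antichains-separate = λ p q s ¬hp ¬hq insp insq → cong toℕ (separate (block-of p) (block-of q) s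
          (block-nonempty p) (block-nonempty q) (nonHom p ¬hp) (nonHom q ¬hq) insp insq)
      }

    contraction : B IsContractionOf A
    contraction = Levels.⇒contraction {E = PA.IsHomogeneous} PB.isHomogeneous? antichains PB.class-not-singleton
      PA.≼⇔LevelOrder PB.≼⇔LevelOrder mono refines

-- Construction of A

find-block : ∀ bs {i} → i < sum bs →
             ∃[ g ] (sum (take g bs) ≤ i × i < sum (take (suc g) bs))
find-block (b ∷ bs) {i} i<Σ with i <? b
... | yes i<b = 0 , z≤n , <-≤-trans i<b (m≤m+n b 0)
... | no i≮b with d , refl ← m≤n⇒∃[o]m+o≡n (≮⇒≥ i≮b)
             with g , ≤d , d< ← find-block bs (+-cancelˡ-< b _ _ i<Σ)
             = suc g , +-monoʳ-≤ b ≤d , +-monoʳ-< b d<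

module Construction {n : ℕ} (m : MultiplicityVector n) (B : SkewedBinaryPartition n)
                    (condition₁ : Condition₁ m B) (condition₂ : Condition₂ m B) (condition₃ : Condition₃ m B)
  where
  open MultiplicityVector m
  open Multiplicity m
  open SkewedBinaryPartition B using (B₀)
  open Partition B
  open Rank level

  private
    b = type B

  rank-zero≤S₀ : rank zero ≤ S b 0
  rank-zero≤S₀ = s≤s⁻¹ (begin
    suc (rank zero)       ≡⟨ rank-zero level ⟨
    C (suc (level zero))  ≤⟨ C-mono (s≤s level-0≤1) ⟩
    C 2                   ≡⟨ C-S 0 ⟩
    suc (S b 0)           ∎)
    where open ≤-Reasoning

  0∈B₀⇒S₀≤rank-zero : level zero ≡ 1 → S b 0 ≤ rank zero
  0∈B₀⇒S₀≤rank-zero l≡1 = ≤-reflexive (suc-injective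
    (trans (sym (C-S 0)) (trans (cong (C ∘ suc) (sym l≡1)) (rank-zero level))))

  ¬low⇒0∈B₀ : ¬ (0 < S b 0 × S b 0 ≤ m₀) → zero ∈ B₀ × level zero ≡ 1
  ¬low⇒0∈B₀ ¬low with lookup-B₀
  ... | inj₁ (eq , _) = ⊥-elim (¬low (Equivalence.from condition₁ eq))
  ... | inj₂ (_ , 0∈ , _ , l≡1) = 0∈ , l≡1

  module Cut′ = Cut rank rank<N #-rank

  1+magnitude : suc (m₀ + sum ms) ≡ suc n
  1+magnitude = cong suc magnitude

  cut-a₀-pos : 0 < m₀ → S b 0 ≤ m₀ → B ∈𝒮ℬ𝒫 m
  cut-a₀-pos 0<m₀ S₀≤m₀ =
    partition , subst (_∈Ω m) (sym type≡) (a₀-pos 0<m₀) , contraction (early refl (proj₂ frame) S₀≤m₀)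
    where
    rank0< : rank zero < suc m₀
    rank0< = s≤s (≤-trans rank-zero≤S₀ S₀≤m₀)
    open Cut′ (suc m₀) 0 ms 1+magnitude positive z≤n
      (<-≤-trans rank0< (≤-reflexive (sym (+-identityʳ _)))) (λ _ → s≤s 0<m₀ , refl)
    type≡ = type-low rank0<
    frame = frame-a₀-pos {m = m} type≡
    -- Monotonicity holds because A is cut from the listing along B: a lower level of B comes
    -- earlier in the listing and so falls into no later segment.
    open Sufficiency {B = B} (proj₁ frame) (λ {p} l<l → f-mono {p} (<⇒≤ (rank-mono-< (key-mono-< l<l))))
      condition₁ condition₂ condition₃

  -- This serves every type whose second entry is `0 °`. The second block consists of the element at
  -- position `S b 0`, and that element is 0, the last of `B₀` in the listing. The frame is
  -- requested for all `A` because the partition itself is built only here.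
  cut-late : ∀ cs → S b 0 + sum cs ≡ n → All (1 ≤_) cs → ¬ (0 < S b 0 × S b 0 ≤ m₀) →
             (∀ {A} → toList (type A) ≡ plain (S b 0) ∷ (0 °) ∷ map plain cs →
               Frame m A (S b 0) × Partition.C A 1 ≡ S b 0) →
             (plain (S b 0) ∷ (0 °) ∷ map plain cs) ∈Ω m → B ∈𝒮ℬ𝒫 m
  cut-late cs Σ≡ cs-positive ¬low frame type∈Ω =
    partition , subst (_∈Ω m) (sym type≡) type∈Ω ,
    contraction (late (proj₂ (frame type≡)) refl (proj₁ (¬low⇒0∈B₀ ¬low)))
    where
    S₀≤rank0 = 0∈B₀⇒S₀≤rank-zero (proj₂ (¬low⇒0∈B₀ ¬low))
    open Cut′ (S b 0) 1 cs (trans (+-suc (S b 0) (sum cs)) (cong suc Σ≡)) cs-positive ≤-refl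
      (≤-trans (s≤s rank-zero≤S₀) (≤-reflexive (+-comm 1 _)))
      (λ rank0< → ⊥-elim (<⇒≱ rank0< S₀≤rank0))
    type≡ = type-high S₀≤rank0
    open Sufficiency {B = B} (proj₁ (frame type≡)) (λ {p} l<l → f-mono {p} (<⇒≤ (rank-mono-< (key-mono-< l<l))))
      condition₁ condition₂ condition₃

  cut-a₀-zero : m₀ ≡ 0 → S b 0 ≡ 0 → B ∈𝒮ℬ𝒫 m
  cut-a₀-zero m₀≡0 S₀≡0 = cut-late ms
    (trans (cong (_+ sum ms) (trans S₀≡0 (sym m₀≡0))) magnitude)
    positive (λ (0<S₀ , _) → <⇒≢ 0<S₀ (sym S₀≡0))
    (subst (λ x → ∀ {A} → toList (type A) ≡ plain x ∷ (0 °) ∷ map plain ms → Frame m A x × Partition.C A 1 ≡ x)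
       (sym S₀≡0) (λ eq → let F , C₁ , _ = frame-a₀-zero m₀≡0 eq in F , C₁))
    (subst (λ x → (plain x ∷ (0 °) ∷ map plain ms) ∈Ω m) (sym S₀≡0) (a₀-zero m₀≡0))

  -- The index `i` is forced: the first entry `m₀ + i` of the type has to equal `S b 0`.
  cut-aᵢ : m₀ < S b 0 → S b 0 < n → B ∈𝒮ℬ𝒫 m
  cut-aᵢ m₀<S₀ S₀<n with i , S₀≡ ← m≤n⇒∃[o]m+o≡n (<⇒≤ m₀<S₀)
                    with i<Σ ← +-cancelˡ-< m₀ i (sum ms)
                                 (≤-<-trans (≤-reflexive S₀≡) (<-≤-trans S₀<n (≤-reflexive (sym magnitude))))
                    with g , ≤i , i< ← find-block ms i<Σ =
      cut-late cs Σ≡ (m<n⇒0<n∸m i< ∷ᵃ drop⁺ (suc g) positive) (λ (_ , S₀≤m₀) → <⇒≱ m₀<S₀ S₀≤m₀)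
        (subst (λ x → ∀ {A} → toList (type A) ≡ plain x ∷ (0 °) ∷ map plain cs → Frame m A x × Partition.C A 1 ≡ x)
           S₀≡ (λ eq → let F , C₁ , _ = frame-aᵢ i g ≤i i< eq in F , C₁))
        (subst (λ x → (plain x ∷ (0 °) ∷ map plain cs) ∈Ω m) S₀≡ (aᵢ i g 1≤i i<Σ ≤i i<))
    where
    Σg = sum (take (suc g) ms)
    cs = (Σg ∸ i) ∷ drop (suc g) ms

    1≤i : 1 ≤ i
    1≤i = +-cancelˡ-< m₀ 0 i (≤-<-trans (≤-reflexive (+-identityʳ m₀)) (<-≤-trans m₀<S₀ (≤-reflexive (sym S₀≡))))

    Σ≡ : S b 0 + sum cs ≡ n
    Σ≡ = begin
      S b 0 + ((Σg ∸ i) + δ)     ≡⟨ cong (_+ sum cs) S₀≡ ⟨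
      m₀ + i + ((Σg ∸ i) + δ)    ≡⟨ +-assoc m₀ i _ ⟩
      m₀ + (i + ((Σg ∸ i) + δ))  ≡⟨ cong (m₀ +_) (+-assoc i _ δ) ⟨
      m₀ + (i + (Σg ∸ i) + δ)    ≡⟨ cong (λ y → m₀ + (y + δ)) (m+[n∸m]≡n (<⇒≤ i<)) ⟩
      m₀ + (Σg + δ)              ≡⟨ cong (m₀ +_) (sum-++ (take (suc g) ms) _) ⟨
      m₀ + sum (take (suc g) ms ++ᴸ drop (suc g) ms) ≡⟨ cong (λ xs → m₀ + sum xs) (take++drop≡id (suc g) ms) ⟩
      m₀ + sum ms                ≡⟨ magnitude ⟩
      n                          ∎
      where
      open ≡-Reasoning
      δ = sum (drop (suc g) ms)

  cut-aᵣ : S b 0 ≡ n → B ∈𝒮ℬ𝒫 m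
  cut-aᵣ S₀≡n = cut-late [] (trans (+-identityʳ _) S₀≡n) []ᵃ
    (λ (_ , S₀≤m₀) → <⇒≱ m₀<n (≤-trans (≤-reflexive (sym S₀≡n)) S₀≤m₀))
    (subst (λ x → ∀ {A} → toList (type A) ≡ plain x ∷ (0 °) ∷ [] → Frame m A x × Partition.C A 1 ≡ x)
       (sym S₀≡n) (λ eq → let F , C₁ , _ = frame-aᵣ eq in F , C₁))
    (subst (λ x → (plain x ∷ (0 °) ∷ []) ∈Ω m) (sym S₀≡n) aᵣ)

  member : B ∈𝒮ℬ𝒫 m
  member with S b 0 ≤? m₀ | m₀ ≟ 0 | S b 0 <? n
  ... | yes S₀≤m₀ | yes m₀≡0 | _ = cut-a₀-zero m₀≡0 (n≤0⇒n≡0 (≤-trans S₀≤m₀ (≤-reflexive m₀≡0)))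
  ... | yes S₀≤m₀ | no m₀≢0  | _ = cut-a₀-pos (n≢0⇒n>0 m₀≢0) S₀≤m₀
  ... | no S₀≰m₀  | _ | yes S₀<n = cut-aᵢ (≰⇒> S₀≰m₀) S₀<n
  ... | no S₀≰m₀  | _ | no S₀≮n  = cut-aᵣ (≤-antisym (S≤n 0) (≮⇒≥ S₀≮n))

proposition5p20 : (n : ℕ) (m : MultiplicityVector n) (B : SkewedBinaryPartition n) →
    let open MultiplicityVector m
        p = SkewedBinaryPartition.k B
        b = type B
    in
    (B ∈𝒮ℬ𝒫 m) ⇔
    (
    ((0 < S b 0 × S b 0 ≤ m₀) ⇔ (lookup b (suc zero) ≡ plain 0))
    ×
    (m₀ < S b 1 ×
    (∀ (i : Fin ℓ) (j j′ : Fin p) → Fits m b i j → Fits m b i j′ → j ≡ j′))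
    ×
    (∀ (j : Fin p) →
    ((∃[ i ] Fits m b i j) →
    ∃[ c ] (1 ≤ c × lookup b (suc (suc j)) ≡ plain c))
    × (¬ (∃[ i ] Fits m b i j) →
    ∃[ c ] (2 ≤ c × lookup b (suc (suc j)) ≡ c ⋆))))
proposition5p20 n m B = mk⇔ to from
  where
  to : B ∈𝒮ℬ𝒫 m → Condition₁ m B × Condition₂ m B × Condition₃ m B
  to (A , type∈Ω , B≺A) with x , F , kind ← Ω⇒frame type∈Ω =
    mk⇔ (low⇒plain0 kind) plain0⇒low , condition₂ , condition₃
    where open Necessity F kind B≺A

  from : Condition₁ m B × Condition₂ m B × Condition₃ m B → B ∈𝒮ℬ𝒫 m
  from (condition₁ , condition₂ , condition₃) = member
    where open Construction m B condition₁ condition₂ condition₃
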